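{- Let $L\geq 1$ be a fixed real number. Then there are only finitely many numbers with the Lehmer property in the set $$ \left\{\frac{g^{n}-1}{g-1}\ \bigg|\ g,n\in\mathbb{N},\ g\geq 2,\ \nu_{2}(g)+\nu_{2}(g+1)\leq L \right\}, $$ and all of them are effectively computable.
   Context: $\mathbb{N}$ denotes the set of positive integers. $\varphi$ is Euler's totient function. A composite positive integer $N$ is said to have the Lehmer property (or to be a Lehmer number) if $\varphi(N)$ divides $N-1$. For a positive integer $m$, $\nu_2(m)$ denotes the $2$-adic valuation of $m$, that is, the exponent of $2$ in the prime factorization of $m$. "Effectively computable" means that there are effective (computable) upper bounds, in terms of $L$ (more precisely of $\lfloor L\rfloor$, on which alone the set depends), for all $g$ and $n$ such that $\frac{g^n-1}{g-1}$ belongs to the set and has the Lehmer property. -}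

module Defs where

open import Data.Integer.Base using (+_)
open import Data.List.Base using (List; filter; length; map; upTo)
open import Data.List.Membership.Propositional using (_∈_)
open import Data.Nat.Base
  using (ℕ; suc; _+_; _*_; _∸_; _^_; _≤_; _/_; NonZero; >-nonZero; s≤s; z≤n)
open import Data.Nat.Coprimality using (coprime?)
open import Data.Nat.Divisibility using (_∣_)
open import Data.Nat.Primality using (Composite)
open import Data.Nat.Primality.Factorisation using (factorise; factors)
open import Data.Nat.Properties using (_≟_; m<n⇒0<n∸m; ≤-trans)
open import Data.Product.Base using (Σ-syntax; ∃-syntax; _×_)
open import Data.Rational.Base as ℚ using (ℚ)
open import Data.Rational.Literals using (fromℤ)
open import Data.Sum.Base using (_⊎_)
open import Function.Bundles using (_⇔_)
open import Relation.Binary.PropositionalEquality.Core using (_≡_)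
open import Relation.Nullary.Negation.Core using (¬_)

-- Two-sided Dedekind reals: `lower q` reads q < x and `upper q` reads x < q.
record ℝ : Set₁ where
  field
    lower upper     : ℚ → Set
    lower-inhabited : ∃[ q ] lower q
    upper-inhabited : ∃[ q ] upper q
    lower-rounded   : ∀ q → lower q ⇔ (∃[ r ] (q ℚ.< r × lower r))
    upper-rounded   : ∀ q → upper q ⇔ (∃[ r ] (r ℚ.< q × upper r))
    disjoint        : ∀ q → ¬ (lower q × upper q)
    located         : ∀ q r → q ℚ.< r → lower q ⊎ upper r

open ℝ public

fromℕ : ℕ → ℚ
fromℕ n = fromℤ (+ n)

infix 4 _≤ᴿ_ _<ᴿ_

_≤ᴿ_ : ℕ → ℝ → Set
k ≤ᴿ x = ¬ upper x (fromℕ k)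

_<ᴿ_ : ℝ → ℕ → Set
x <ᴿ k = upper x (fromℕ k)

-- A Dedekind real has no computable floor, so ⌊ x ⌋ ≡ ℓ is a relation.
IsFloor : ℝ → ℕ → Set
IsFloor x ℓ = ℓ ≤ᴿ x × x <ᴿ suc ℓ

φ : ℕ → ℕ
φ n = length (filter (λ k → coprime? k n) (map suc (upTo n)))

Lehmer : ℕ → Set
Lehmer N = Composite N × φ N ∣ N ∸ 1

ν₂ : (m : ℕ) → .{{NonZero m}} → ℕ
ν₂ m = length (filter (2 ≟_) (factors (factorise m)))

-- The division is exact, so the floor in ℕ's _/_ loses nothing.
repunit : (g n : ℕ) → 2 ≤ g → ℕ
repunit g n 2≤g = ((g ^ n ∸ 1) / (g ∸ 1)) {{>-nonZero (m<n⇒0<n∸m 2≤g)}}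

ν₂[g]+ν₂[g+1] : (g : ℕ) → 2 ≤ g → ℕ
ν₂[g]+ν₂[g+1] g 2≤g = ν₂ g {{>-nonZero (≤-trans (s≤s z≤n) 2≤g)}} + ν₂ (suc g)

RepunitSet : ℝ → ℕ → Set
RepunitSet L N =
  ∃[ g ] ∃[ n ] Σ[ 2≤g ∈ 2 ≤ g ]
    (1 ≤ n × ν₂[g]+ν₂[g+1] g 2≤g ≤ᴿ L × N ≡ repunit g n 2≤g)

-- P need not be decidable, so the list may contain further numbers.
Finite : (ℕ → Set) → Set
Finite P = ∃[ xs ] (∀ N → P N → N ∈ xs)

{-# OPTIONS --safe #-}
module Submission where

-- A Lehmer number N is odd and squarefree, so k primes dividing N contribute 2^k to φ(N) ∣ N - 1; for
-- N = 1 + g + ⋯ + g^(n-1) with ν₂(g) + ν₂(g+1) ≤ ℓ this gives 2^k ≤ 2^ℓ (n - 1).  Nielsen's argument bounds N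
-- by 4^(2^k), hence g by 4^(2^ℓ).  Applied only to the primes p of N that do not divide 1 + g + ⋯ + g^(e-1),
-- where e is a proper divisor of n, it bounds the least such p in terms of ℓ and e.  The order of g modulo p
-- divides n but not e, so r = gcd (n / e) (p - 1) > 1, and e r is a larger divisor of n of bounded size.  This produces
-- a chain of divisors of n starting at a bounded prime q.  Every step of the chain contributes a new prime
-- ≡ 1 (mod q) to N, whereas q^j ∣ N - 1 forces q^j ≤ g^q because q ∣ n; so the chain reaches n after
-- boundedly many steps.

open import Defs
open import Data.Integer.Base as ℤ using ()
import Data.Integer.Properties as ℤ
open import Data.List.Base using (List; []; _∷_; _++_; length; map; filter; upTo; [_])
open import Data.List.Membership.Propositional.Properties using (∈-upTo⁺)
open import Data.List.Properties using (map-++; length-++; ++-assoc; filter-++; upTo-∷ʳ)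
open import Data.List.Relation.Binary.Permutation.Propositional using (_↭_; ↭-refl; ↭-sym; ↭-trans; prep)
open import Data.List.Relation.Binary.Permutation.Propositional.Properties
  using (All-resp-↭; shift; ↭-length) renaming (map⁺ to ↭-map⁺)
open import Data.List.Relation.Unary.All as All using (All; []; _∷_)
open import Data.List.Relation.Unary.All.Properties using () renaming (++⁻ˡ to All-++⁻ˡ; ++⁻ʳ to All-++⁻ʳ)
open import Data.List.Relation.Unary.AllPairs using (AllPairs; []; _∷_)
open import Data.List.Relation.Unary.Linked.Properties using (Linked⇒AllPairs)
open import Data.Nat.Base
open import Data.Nat.Combinatorics
  using (_C_; nCn≡1; nCk≡n!/k![n-k]!; k>n⇒nCk≡0; nCk+nC[k+1]≡[n+1]C[k+1]; k![n∸k]!∣n!)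
open import Data.Nat.Coprimality as Coprimality using (Coprime; coprime?; coprime-divisor; coprime-Bézout)
open import Data.Nat.Divisibility
open import Data.Nat.DivMod using (m/n*n≡m; m*n/n≡m)
open import Data.Nat.GCD using (gcd; gcd[m,n]∣m; gcd[m,n]∣n; module Bézout)
open import Data.Nat.ListAction using (product)
open import Data.Nat.ListAction.Properties using (product-++; product-↭)
open import Data.Nat.Primality
open import Data.Nat.Primality.Factorisation
open import Data.Nat.Properties
open import Data.Nat.Tactic.RingSolver using (solve-∀)
open import Data.List.Sort ≤-decTotalOrder using (sort; sort-↭; sort-↗)
open import Data.Product.Base using (Σ-syntax; ∃-syntax; _×_; _,_; proj₁; proj₂)
open import Data.Rational.Base as ℚ using (ℚ; mkℚ)
import Data.Rational.Properties as ℚ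
open import Data.Sum.Base using (_⊎_; inj₁; inj₂; [_,_]′)
open import Function.Base using (_∘_)
open import Function.Bundles using (Equivalence)
open import Relation.Binary.Definitions using (tri<; tri≈; tri>)
open import Relation.Binary.PropositionalEquality hiding ([_])
open import Relation.Nullary using (¬_; Dec; yes; no; contradiction)

-- Putting 2^k ≤ 2^ℓ (n - 1) into g^(n-1) ≤ N ≤ 4^(2^k) and taking an (n-1)-st root removes n, so
-- Nielsen's inequality by itself bounds the base and says nothing about the exponent. What it
-- leaves for the exponent is a loss in its own proof. The primes are consumed in blocks; a block of
-- j primes is allowed to raise the running bound to its 2^j-th power, while its actual contribution
-- Q has a logarithm only quadratic in j. Estimating the first block by Q and the at most k - j
-- later primes as usual gives N ≤ Q^(2^(k-j)), and the same root turns this into g^(2^j) ≤ Q^(2^ℓ).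
-- This bounds j, and with j the first prime of the block. The estimate q^j ≤ g^q is lifting the
-- exponent: q ∣ n implies q ∤ n - 1, so the exponent of g^(n-1) - 1 contributes no power of q. Two
-- degenerate cases, p ∣ g - 1 and p = q, are excluded because a Lehmer repunit is coprime to its
-- exponent.

prime⇒2≤ : ∀ {p} → Prime p → 2 ≤ p
prime⇒2≤ {p} pp = nonTrivial⇒n>1 p {{prime⇒nonTrivial pp}}

prime≢1 : ∀ {p} → Prime p → p ≢ 1
prime≢1 pp refl = ¬prime[1] pp

prime-∣-prime : ∀ {p q} → Prime p → Prime q → p ∣ q → p ≡ q
prime-∣-prime pp pq p∣q with prime⇒irreducible pq p∣q
... | inj₁ p≡1 = contradiction p≡1 (prime≢1 pp)
... | inj₂ p≡q = p≡q

prime∧∤⇒coprime : ∀ {p n} → Prime p → p ∤ n → Coprime p n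
prime∧∤⇒coprime pp p∤n (d∣p , d∣n) with prime⇒irreducible pp d∣p
... | inj₁ d≡1  = d≡1
... | inj₂ refl = contradiction d∣n p∤n

coprime-*ˡ : ∀ {m n o} → Coprime m o → Coprime n o → Coprime (m * n) o
coprime-*ˡ m⊥o n⊥o (d∣mn , d∣o) =
  n⊥o (coprime-divisor (λ (e∣d , e∣m) → m⊥o (e∣m , ∣-trans e∣d d∣o)) d∣mn , d∣o)

coprime-^ˡ : ∀ {m o} n → Coprime m o → Coprime (m ^ n) o
coprime-^ˡ zero    _   (d∣1 , _) = ∣1⇒≡1 d∣1
coprime-^ˡ (suc n) m⊥o = coprime-*ˡ m⊥o (coprime-^ˡ n m⊥o)

-- Congruence to 1

infix 4 _≡1[_]

-- One-sided: the witness is a natural number, so the relation entails x ≥ 1 and no subtraction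
-- occurs.
_≡1[_] : ℕ → ℕ → Set
x ≡1[ m ] = ∃[ t ] x ≡ 1 + t * m

≡1⇒∣pred : ∀ {x m} → x ≡1[ m ] → m ∣ pred x
≡1⇒∣pred (t , refl) = n∣m*n t

≡1-* : ∀ {m x y} → x ≡1[ m ] → y ≡1[ m ] → x * y ≡1[ m ]
≡1-* {m} (s , refl) (t , refl) = s + t + s * t * m , lemma s t m
  where
  lemma : ∀ s t m → (1 + s * m) * (1 + t * m) ≡ 1 + (s + t + s * t * m) * m
  lemma = solve-∀

≡1-^ : ∀ {m x} n → x ≡1[ m ] → x ^ n ≡1[ m ]
≡1-^ zero    _   = 0 , refl
≡1-^ (suc n) x≡1 = ≡1-* x≡1 (≡1-^ n x≡1)

≡1-^-* : ∀ {m x} u a → x ^ a ≡1[ m ] → x ^ (u * a) ≡1[ m ]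
≡1-^-* {m} {x} u a xᵃ =
  subst (_≡1[ m ]) (trans (^-*-assoc x a u) (cong (x ^_) (*-comm a u))) (≡1-^ u xᵃ)

≡1-cancelʳ : ∀ {m} x y .{{_ : NonZero x}} → x * y ≡1[ m ] → y ≡1[ m ] → x ≡1[ m ]
≡1-cancelʳ {m} (suc x) _ (s , eq) (t , refl) with ∣m+n∣m⇒∣n (divides s step) (n∣m*n (suc x * t))
  where
  lemma : ∀ x t m → suc (suc x * t * m + x) ≡ suc x * (1 + t * m)
  lemma = solve-∀
  step : suc x * t * m + x ≡ s * m
  step = suc-injective (trans (lemma x t m) eq)
... | divides u x≡um = u , cong suc x≡um

-- By Bézout, some multiple of one exponent exceeds a multiple of the other by 1, so x is the
-- quotient of two powers that are both ≡ 1.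
≡1-coprime-exponents : ∀ {m a b} x .{{_ : NonZero x}} → Coprime a b →
                       x ^ a ≡1[ m ] → x ^ b ≡1[ m ] → x ≡1[ m ]
≡1-coprime-exponents {m} {a} {b} x a⊥b xᵃ xᵇ with coprime-Bézout a⊥b
... | Bézout.Identity.+- u v eq = ≡1-cancelʳ x (x ^ (v * b))
  (subst (λ e → x ^ e ≡1[ m ]) (sym eq) (≡1-^-* u a xᵃ)) (≡1-^-* v b xᵇ)
... | Bézout.Identity.-+ u v eq = ≡1-cancelʳ x (x ^ (u * a))
  (subst (λ e → x ^ e ≡1[ m ]) (sym eq) (≡1-^-* v b xᵇ)) (≡1-^-* u a xᵃ)

-- Fermat's little theorem

module _ (a : ℕ) where

  binomialSum : ℕ → ℕ → ℕ
  binomialSum n zero    = 0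
  binomialSum n (suc m) = binomialSum n m + (n C m) * a ^ m

  -- Pascal's rule for truncated rows: cutting row n + 1 one term later than row n leaves a single
  -- boundary term, which vanishes once the row is complete.
  binomialSum-suc : ∀ n m → binomialSum (suc n) (suc m) ≡ suc a * binomialSum n m + (n C m) * a ^ m
  binomialSum-suc n zero    = cong (_+ (n C 0) * 1) (sym (*-zeroʳ (suc a)))
  binomialSum-suc n (suc m) = begin
    binomialSum (suc n) (suc m) + (suc n C suc m) * (a * a ^ m)
      ≡⟨ cong₂ (λ x y → x + y * (a * a ^ m)) (binomialSum-suc n m) (sym (nCk+nC[k+1]≡[n+1]C[k+1] n m)) ⟩
    suc a * binomialSum n m + (n C m) * a ^ m + ((n C m) + (n C suc m)) * (a * a ^ m)
      ≡⟨ lemma a (binomialSum n m) (n C m) (n C suc m) (a ^ m) ⟩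
    suc a * (binomialSum n m + (n C m) * a ^ m) + (n C suc m) * (a * a ^ m) ∎
    where
    open ≡-Reasoning
    lemma : ∀ a b c d e → suc a * b + c * e + (c + d) * (a * e) ≡ suc a * (b + c * e) + d * (a * e)
    lemma = solve-∀

  binomial : ∀ n → suc a ^ n ≡ binomialSum n (suc n)
  binomial zero    = refl
  binomial (suc n) = begin
    suc a * suc a ^ n
      ≡⟨ cong (suc a *_) (binomial n) ⟩
    suc a * binomialSum n (suc n)
      ≡⟨ +-identityʳ _ ⟨
    suc a * binomialSum n (suc n) + 0 * a ^ suc n
      ≡⟨ cong (λ c → suc a * binomialSum n (suc n) + c * a ^ suc n) (k>n⇒nCk≡0 (n<1+n n)) ⟨
    suc a * binomialSum n (suc n) + (n C suc n) * a ^ suc n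
      ≡⟨ binomialSum-suc n (suc n) ⟨
    binomialSum (suc n) (2 + n) ∎
    where open ≡-Reasoning

prime∤! : ∀ {p} n → Prime p → n < p → p ∤ n !
prime∤! zero    pp _   p∣1 = prime≢1 pp (∣1⇒≡1 p∣1)
prime∤! (suc n) pp n<p p∣  with euclidsLemma (suc n) (n !) pp p∣
... | inj₁ p∣n  = <⇒≱ n<p (∣⇒≤ p∣n)
... | inj₂ p∣n! = prime∤! n pp (<-trans (n<1+n n) n<p) p∣n!

-- p divides p! = C(p, k) · k! · (p - k)!, but neither of the two smaller factorials.
prime∣C : ∀ {p k} → Prime p → 1 ≤ k → k < p → p ∣ p C k
prime∣C {p@(suc p-1)} {k@(suc _)} pp 1≤k k<p
  with euclidsLemma (p C k) (k ! * (p ∸ k) !) pp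
         (subst (p ∣_) (sym eq) (m∣m*n (p-1 !)))
  where
  instance
    nz : NonZero (k ! * (p ∸ k) !)
    nz = m*n≢0 (k !) ((p ∸ k) !) {{k !≢0}} {{(p ∸ k) !≢0}}
  eq : (p C k) * (k ! * (p ∸ k) !) ≡ p !
  eq = trans (cong (_* (k ! * (p ∸ k) !)) (nCk≡n!/k![n-k]! (<⇒≤ k<p))) (m/n*n≡m (k![n∸k]!∣n! (<⇒≤ k<p)))
... | inj₁ p∣C = p∣C
... | inj₂ p∣! with euclidsLemma (k !) ((p ∸ k) !) pp p∣!
...   | inj₁ p∣k! = contradiction p∣k! (prime∤! k pp k<p)
...   | inj₂ p∣[p∸k]! = contradiction p∣[p∸k]! (prime∤! (p ∸ k) pp (∸-monoʳ-< {p} z<s (<⇒≤ k<p)))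

binomialSum≡1 : ∀ {p} a k → Prime p → suc k ≤ p → binomialSum a p (suc k) ≡1[ p ]
binomialSum≡1 {p} a zero    pp _   = 0 , refl
binomialSum≡1 {p} a (suc k) pp k<p with binomialSum≡1 a k pp (<⇒≤ k<p) | prime∣C pp (s≤s (z≤n {k})) k<p
... | t , eq | divides u eq′ = t + u * a ^ suc k , trans (cong₂ (λ x y → x + y * a ^ suc k) eq eq′) (lemma t u p (a ^ suc k))
  where
  lemma : ∀ t u p b → 1 + t * p + u * p * b ≡ 1 + (t + u * b) * p
  lemma = solve-∀

fermat : ∀ {p} a → Prime p → ∃[ t ] a ^ p ≡ a + t * p
fermat {p@(suc _)} zero    pp = 0 , refl
fermat {p@(suc p-1)} (suc a) pp with fermat a pp | binomialSum≡1 a p-1 pp ≤-refl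
... | t , eq | s , eq′ = s + t , (begin
    suc a ^ p                              ≡⟨ binomial a p ⟩
    binomialSum a p p + (p C p) * a ^ p    ≡⟨ cong₂ (λ x y → x + y * a ^ p) eq′ (nCn≡1 p) ⟩
    1 + s * p + 1 * a ^ p                  ≡⟨ cong (λ x → 1 + s * p + 1 * x) eq ⟩
    1 + s * p + 1 * (a + t * p)            ≡⟨ lemma s t p a ⟩
    suc a + (s + t) * p                    ∎)
  where
  open ≡-Reasoning
  lemma : ∀ s t p a → 1 + s * p + 1 * (a + t * p) ≡ suc a + (s + t) * p
  lemma = solve-∀

∤⇒nonZero : ∀ {p x} → p ∤ x → NonZero x
∤⇒nonZero {p} {zero}  p∤0 = contradiction (p ∣0) p∤0
∤⇒nonZero {p} {suc x} _   = _

fermat-unit : ∀ {p x} → Prime p → p ∤ x → x ^ (p ∸ 1) ≡1[ p ]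
fermat-unit {p@(suc p-1)} {x} pp p∤x with fermat x pp | m^n>0 x {{∤⇒nonZero p∤x}} p-1
... | t , eq | pos with x ^ p-1 in eq′
... | suc z with euclidsLemma x z pp (divides t (+-cancelˡ-≡ x _ _ (trans (sym (*-suc x z)) eq)))
...   | inj₁ p∣x = contradiction p∣x p∤x
...   | inj₂ (divides u eq″) = u , cong suc eq″

-- x^e is ≡ 1 when raised to f, and by Fermat when raised to p - 1. This serves in place of the
-- order of x modulo p, which is never constructed.
coprime-exponent : ∀ {p x} e f → Prime p → p ∤ x → x ^ (e * f) ≡1[ p ] → Coprime f (p ∸ 1) → x ^ e ≡1[ p ]
coprime-exponent {p} {x} e f pp p∤x x^ef f⊥p-1 =
  ≡1-coprime-exponents (x ^ e) {{m^n≢0 x e {{∤⇒nonZero p∤x}}}} f⊥p-1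
    (subst (_≡1[ p ]) (sym (^-*-assoc x e f)) x^ef)
    (subst (_≡1[ p ]) (trans (^-*-assoc x (p ∸ 1) e) (trans (cong (x ^_) (*-comm (p ∸ 1) e)) (sym (^-*-assoc x e (p ∸ 1)))))
      (≡1-^ e (fermat-unit pp p∤x)))

-- Geometric sums

geom : ℕ → ℕ → ℕ
geom x zero    = 0
geom x (suc n) = 1 + x * geom x n

geom-1 : ∀ x → geom x 1 ≡ 1
geom-1 x = cong suc (*-zeroʳ x)

geom-^ : ∀ y n → suc y ^ n ≡ 1 + geom (suc y) n * y
geom-^ y zero    = refl
geom-^ y (suc n) = trans (cong (suc y *_) (geom-^ y n)) (lemma y (geom (suc y) n))
  where
  lemma : ∀ y s → suc y * (1 + s * y) ≡ 1 + (1 + suc y * s) * y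
  lemma = solve-∀

geom-+ : ∀ x m n → geom x (m + n) ≡ geom x m + x ^ m * geom x n
geom-+ x zero    n = sym (*-identityˡ (geom x n))
geom-+ x (suc m) n = trans (cong (λ s → 1 + x * s) (geom-+ x m n)) (lemma x (geom x m) (x ^ m) (geom x n))
  where
  lemma : ∀ x a b c → 1 + x * (a + b * c) ≡ 1 + x * a + x * b * c
  lemma = solve-∀

geom-* : ∀ x m n → geom x (m * n) ≡ geom x m * geom (x ^ m) n
geom-* x m zero    = trans (cong (geom x) (*-zeroʳ m)) (sym (*-zeroʳ (geom x m)))
geom-* x m (suc n) = begin
  geom x (m * suc n)                               ≡⟨ cong (geom x) (*-suc m n) ⟩
  geom x (m + m * n)                               ≡⟨ geom-+ x m (m * n) ⟩
  geom x m + x ^ m * geom x (m * n)                ≡⟨ cong (λ s → geom x m + x ^ m * s) (geom-* x m n) ⟩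
  geom x m + x ^ m * (geom x m * geom (x ^ m) n)   ≡⟨ lemma (geom x m) (x ^ m) (geom (x ^ m) n) ⟩
  geom x m * (1 + x ^ m * geom (x ^ m) n)          ∎
  where
  open ≡-Reasoning
  lemma : ∀ a b c → a + b * (a * c) ≡ a * (1 + b * c)
  lemma = solve-∀

geom-mod : ∀ y n → ∃[ t ] geom (suc y) n ≡ n + t * y
geom-mod y zero    = 0 , refl
geom-mod y (suc n) with geom-mod y n
... | t , eq = t + n + y * t , trans (cong (λ s → 1 + suc y * s) eq) (lemma y n t)
  where
  lemma : ∀ y n t → 1 + suc y * (n + t * y) ≡ suc n + (t + n + y * t) * y
  lemma = solve-∀

geom-∣ : ∀ x {m n} → m ∣ n → geom x m ∣ geom x n
geom-∣ x {m} (divides q refl) =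
  divides (geom (x ^ m) q) (trans (cong (geom x) (*-comm q m)) (trans (geom-* x m q) (*-comm (geom x m) _)))

∣geom⇒∤base : ∀ {p x} n → p ≢ 1 → p ∣ geom x n → 1 ≤ n → p ∤ x
∣geom⇒∤base {p} {x} (suc n) p≢1 p∣ _ p∣x =
  p≢1 (∣1⇒≡1 (∣m+n∣m⇒∣n (subst (p ∣_) (+-comm 1 _) p∣) (∣m⇒∣m*n (geom x n) p∣x)))

∣geom⇒≡1 : ∀ {p} x .{{_ : NonZero x}} n → p ∣ geom x n → x ^ n ≡1[ p ]
∣geom⇒≡1 {p} (suc y) n (divides s eq) = s * y , trans (geom-^ y n) (cong suc (trans (cong (_* y) eq) (lemma s p y)))
  where
  lemma : ∀ s p y → s * p * y ≡ s * y * p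
  lemma = solve-∀

≡1⇒∣geom : ∀ {p x} n → Prime p → p ∤ x ∸ 1 → x ^ n ≡1[ p ] → p ∣ geom x n
≡1⇒∣geom {p} {zero} n pp p∤ _ = contradiction (p ∣0) p∤
≡1⇒∣geom {p} {suc y} n pp p∤y (t , eq) with euclidsLemma (geom (suc y) n) y pp
  (divides t (suc-injective (trans (sym (geom-^ y n)) eq)))
... | inj₁ p∣geom = p∣geom
... | inj₂ p∣y    = contradiction p∣y p∤y

-- Modulo p each of the n terms of the sum is 1.
∣geom∧≡1⇒∣exponent : ∀ {p x} n → p ∣ geom x n → x ≡1[ p ] → p ∣ n
∣geom∧≡1⇒∣exponent {p} n p∣ (t , refl) with geom-mod (t * p) n
... | u , eq = ∣m+n∣m⇒∣n (subst (p ∣_) (trans eq (+-comm n _)) p∣) (∣n⇒∣m*n u (n∣m*n t))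

-- A prime p ∣ 1 + x + ⋯ + x^(q-1) other than q makes x an element of order q modulo p.
∣geom⇒∣pred : ∀ {p q g} f .{{_ : NonZero g}} → Prime p → Prime q → p ≢ q →
               p ∣ geom (g ^ f) q → q ∣ p ∸ 1
∣geom⇒∣pred {p} {q} {g} f pp pq p≢q p∣ with q ∣? p ∸ 1
... | yes q∣p-1 = q∣p-1
... | no  q∤p-1 = contradiction (prime-∣-prime pp pq (∣geom∧≡1⇒∣exponent q p∣ x≡1)) p≢q
  where
  instance
    x≢0 : NonZero (g ^ f)
    x≢0 = m^n≢0 g f
  x≡1 : g ^ f ≡1[ p ]
  x≡1 = subst (_≡1[ p ]) (*-identityʳ (g ^ f)) (coprime-exponent 1 q pp
    (∣geom⇒∤base q (prime≢1 pp) p∣ (<⇒≤ (prime⇒2≤ pq)))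
    (subst (λ e → (g ^ f) ^ e ≡1[ p ]) (sym (*-identityˡ q)) (∣geom⇒≡1 (g ^ f) q p∣))
    (prime∧∤⇒coprime pq q∤p-1))

geom≥1 : ∀ x {n} → 1 ≤ n → 1 ≤ geom x n
geom≥1 x {suc n} _ = s≤s z≤n

geom-lower : ∀ x n → x ^ n ≤ geom x (suc n)
geom-lower x zero    = s≤s z≤n
geom-lower x (suc n) = m≤n⇒m≤1+n (*-monoʳ-≤ x (geom-lower x n))

geom-upper : ∀ x n → 2 ≤ x → suc (geom x n) ≤ x ^ n
geom-upper (suc y) n (s≤s 1≤y) = subst (suc (geom (suc y) n) ≤_) (sym (geom-^ y n))
  (s≤s (m≤m*n _ y {{>-nonZero 1≤y}}))

geom-mono-≤ : ∀ {x y} n → x ≤ y → geom x n ≤ geom y n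
geom-mono-≤ zero    _   = z≤n
geom-mono-≤ (suc n) x≤y = s≤s (*-mono-≤ x≤y (geom-mono-≤ n x≤y))

geom-mono-< : ∀ {x y} n → 2 ≤ n → x < y → geom x n < geom y n
geom-mono-< {x} {y} (suc (suc n)) _ x<y = s<s (<-≤-trans
  (*-monoˡ-< (geom x (suc n)) x<y)
  (*-monoʳ-≤ y (geom-mono-≤ (suc n) (<⇒≤ x<y))))
geom-mono-< (suc zero) (s≤s ()) _

geom-> : ∀ {x} n → 2 ≤ n → 2 ≤ x → n < geom x n
geom-> {x} n 2≤n 2≤x = subst (_< geom x n) (geom-base-1 n) (geom-mono-< n 2≤n 2≤x)
  where
  geom-base-1 : ∀ n → geom 1 n ≡ n
  geom-base-1 zero    = refl
  geom-base-1 (suc n) = cong suc (trans (+-identityʳ _) (geom-base-1 n))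

-- The totient function

sumTo : (ℕ → ℕ) → ℕ → ℕ
sumTo f zero    = 0
sumTo f (suc n) = sumTo f n + f (suc n)

sumTo-cong : ∀ {f g} n → (∀ k → f k ≡ g k) → sumTo f n ≡ sumTo g n
sumTo-cong zero    _  = refl
sumTo-cong (suc n) eq = cong₂ _+_ (sumTo-cong n eq) (eq (suc n))

sumTo-+ : ∀ f m n → sumTo f (m + n) ≡ sumTo f m + sumTo (f ∘ (m +_)) n
sumTo-+ f m zero    = trans (cong (sumTo f) (+-identityʳ m)) (sym (+-identityʳ _))
sumTo-+ f m (suc n) = begin
  sumTo f (m + suc n)                                  ≡⟨ cong (sumTo f) (+-suc m n) ⟩
  sumTo f (m + n) + f (suc (m + n))                    ≡⟨ cong₂ _+_ (sumTo-+ f m n) (cong f (sym (+-suc m n))) ⟩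
  sumTo f m + sumTo (f ∘ (m +_)) n + f (m + suc n)     ≡⟨ +-assoc (sumTo f m) _ _ ⟩
  sumTo f m + sumTo (f ∘ (m +_)) (suc n)               ∎
  where open ≡-Reasoning

sumTo-distrib-+ : ∀ f g n → sumTo (λ k → f k + g k) n ≡ sumTo f n + sumTo g n
sumTo-distrib-+ f g zero    = refl
sumTo-distrib-+ f g (suc n) = trans (cong (_+ (f (suc n) + g (suc n))) (sumTo-distrib-+ f g n))
  (lemma (sumTo f n) (sumTo g n) (f (suc n)) (g (suc n)))
  where
  lemma : ∀ a b c d → a + b + (c + d) ≡ a + c + (b + d)
  lemma = solve-∀

sumTo-periodic : ∀ f m r → (∀ k → f (m + k) ≡ f k) → sumTo f (r * m) ≡ r * sumTo f m
sumTo-periodic f m zero    _      = refl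
sumTo-periodic f m (suc r) period = trans (sumTo-+ f m (r * m))
  (cong (sumTo f m +_) (trans (sumTo-cong (r * m) period) (sumTo-periodic f m r period)))

sumTo-zero : ∀ f n → (∀ k → 1 ≤ k → k ≤ n → f k ≡ 0) → sumTo f n ≡ 0
sumTo-zero f zero    _  = refl
sumTo-zero f (suc n) f0 = cong₂ _+_ (sumTo-zero f n (λ k 1≤k k≤n → f0 k 1≤k (m≤n⇒m≤1+n k≤n))) (f0 (suc n) (s≤s z≤n) ≤-refl)

sumTo-multiples : ∀ f p m .{{_ : NonZero p}} → (∀ k → p ∤ k → f k ≡ 0) → sumTo f (m * p) ≡ sumTo (λ k → f (k * p)) m
sumTo-multiples f p         zero    _  = refl
sumTo-multiples f p@(suc r) (suc m) f0 = begin
  sumTo f (p + m * p)                                             ≡⟨ cong (sumTo f) (+-comm p (m * p)) ⟩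
  sumTo f (m * p + p)                                             ≡⟨ sumTo-+ f (m * p) p ⟩
  sumTo f (m * p) + (sumTo (f ∘ (m * p +_)) r + f (m * p + p))    ≡⟨ cong (λ s → sumTo f (m * p) + (s + f (m * p + p))) inner ⟩
  sumTo f (m * p) + f (m * p + p)                                 ≡⟨ cong₂ _+_ (sumTo-multiples f p m f0) (cong f (+-comm (m * p) p)) ⟩
  sumTo (λ k → f (k * p)) (suc m)                                 ∎
  where
  open ≡-Reasoning
  inner : sumTo (f ∘ (m * p +_)) r ≡ 0
  inner = sumTo-zero _ r λ k 1≤k k≤r → f0 _ λ p∣ →
    <⇒≱ (s≤s k≤r) (∣⇒≤ {{>-nonZero 1≤k}} (∣m+n∣m⇒∣n p∣ (n∣m*n m)))

indicator : ∀ {P : Set} → Dec P → ℕ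
indicator (yes _) = 1
indicator (no  _) = 0

indicator-cong : ∀ {P Q : Set} (p? : Dec P) (q? : Dec Q) → (P → Q) → (Q → P) → indicator p? ≡ indicator q?
indicator-cong (yes p) (yes q) _  _  = refl
indicator-cong (yes p) (no ¬q) to _  = contradiction (to p) ¬q
indicator-cong (no ¬p) (yes q) _  fr = contradiction (fr q) ¬p
indicator-cong (no ¬p) (no ¬q) _  _  = refl

totative : ℕ → ℕ → ℕ
totative n k = indicator (coprime? k n)

length-filter-upTo : ∀ {P : ℕ → Set} (P? : ∀ k → Dec (P k)) n →
                     length (filter P? (map suc (upTo n))) ≡ sumTo (indicator ∘ P?) n
length-filter-upTo P? zero    = refl
length-filter-upTo P? (suc n) = begin
  length (filter P? (map suc (upTo (suc n))))
    ≡⟨ cong (length ∘ filter P? ∘ map suc) (upTo-∷ʳ n) ⟨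
  length (filter P? (map suc (upTo n ++ [ n ])))
    ≡⟨ cong (length ∘ filter P?) (map-++ suc (upTo n) [ n ]) ⟩
  length (filter P? (map suc (upTo n) ++ [ suc n ]))
    ≡⟨ cong length (filter-++ P? (map suc (upTo n)) [ suc n ]) ⟩
  length (filter P? (map suc (upTo n)) ++ filter P? [ suc n ])
    ≡⟨ length-++ (filter P? (map suc (upTo n))) ⟩
  length (filter P? (map suc (upTo n))) + length (filter P? [ suc n ])
    ≡⟨ cong₂ _+_ (length-filter-upTo P? n) length-filter-[] ⟩
  sumTo (indicator ∘ P?) (suc n) ∎
  where
  open ≡-Reasoning
  length-filter-[] : length (filter P? [ suc n ]) ≡ indicator (P? (suc n))
  length-filter-[] with P? (suc n)
  ... | yes _ = refl
  ... | no  _ = refl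

φ≡sumTo : ∀ n → φ n ≡ sumTo (totative n) n
φ≡sumTo n = length-filter-upTo (λ k → coprime? k n) n

sumTo-totative : ∀ r m → sumTo (totative m) (r * m) ≡ r * φ m
sumTo-totative r m = trans (sumTo-periodic (totative m) m r period) (cong (r *_) (sym (φ≡sumTo m)))
  where
  period : ∀ k → totative m (m + k) ≡ totative m k
  period k = indicator-cong (coprime? (m + k) m) (coprime? k m)
    (λ c (d∣k , d∣m) → c (∣m∣n⇒∣m+n d∣m d∣k , d∣m))
    (λ c (d∣m+k , d∣m) → c (∣m+n∣m⇒∣n d∣m+k d∣m , d∣m))

-- As p ∣ m, being prime to p m and being prime to m are the same condition, counted over p periods
-- of length m.
φ-*-∣ : ∀ {p} m → Prime p → p ∣ m → φ (p * m) ≡ p * φ m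
φ-*-∣ {p} m pp p∣m = begin
  φ (p * m)                          ≡⟨ φ≡sumTo (p * m) ⟩
  sumTo (totative (p * m)) (p * m)   ≡⟨ sumTo-cong (p * m) same ⟩
  sumTo (totative m) (p * m)         ≡⟨ sumTo-totative p m ⟩
  p * φ m                            ∎
  where
  open ≡-Reasoning
  coprime-p : ∀ {k} → Coprime k m → Coprime p k
  coprime-p c = prime∧∤⇒coprime pp λ p∣k → prime≢1 pp (c (p∣k , p∣m))
  same : ∀ k → totative (p * m) k ≡ totative m k
  same k = indicator-cong (coprime? k (p * m)) (coprime? k m)
    (λ c (d∣k , d∣m) → c (d∣k , ∣n⇒∣m*n p d∣m))
    (λ c → Coprimality.sym (coprime-*ˡ (coprime-p c) (Coprimality.sym c)))

-- Among the p · φ m numbers up to p m that are prime to m, those not divisible by p are counted by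
-- φ (p m), and the multiples k p by φ m, since k p is prime to m exactly when k is. Adding φ m on
-- both sides avoids subtraction.
φ-*-∤ : ∀ {p} m → Prime p → p ∤ m → φ (p * m) ≡ (p ∸ 1) * φ m
φ-*-∤ {p@(suc p-1)} m pp p∤m = +-cancelʳ-≡ (φ m) _ _ (begin
  φ (p * m) + φ m
    ≡⟨ cong₂ _+_ (φ≡sumTo (p * m)) (trans (φ≡sumTo m) (sym (trans (sumTo-multiples excluded p m excluded-∤) (sumTo-cong m excluded-∣)))) ⟩
  sumTo (totative (p * m)) (p * m) + sumTo excluded (m * p)
    ≡⟨ cong (λ n → sumTo (totative (p * m)) (p * m) + sumTo excluded n) (*-comm m p) ⟩
  sumTo (totative (p * m)) (p * m) + sumTo excluded (p * m)
    ≡⟨ sumTo-distrib-+ (totative (p * m)) excluded (p * m) ⟨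
  sumTo (λ k → totative (p * m) k + excluded k) (p * m)
    ≡⟨ sumTo-cong (p * m) split ⟩
  sumTo (totative m) (p * m)
    ≡⟨ sumTo-totative p m ⟩
  p * φ m
    ≡⟨ +-comm (φ m) _ ⟩
  p-1 * φ m + φ m ∎)
  where
  open ≡-Reasoning
  excluded : ℕ → ℕ
  excluded k = indicator (p ∣? k) * totative m k
  excluded-∤ : ∀ k → p ∤ k → excluded k ≡ 0
  excluded-∤ k p∤k with p ∣? k
  ... | yes p∣k = contradiction p∣k p∤k
  ... | no  _   = refl
  excluded-∣ : ∀ k → excluded (k * p) ≡ totative m k
  excluded-∣ k with p ∣? k * p
  ... | no  p∤kp = contradiction (n∣m*n k) p∤kp
  ... | yes _    = trans (+-identityʳ _) (indicator-cong (coprime? (k * p) m) (coprime? k m)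
    (λ c (d∣k , d∣m) → c (∣m⇒∣m*n p d∣k , d∣m))
    (λ c → coprime-*ˡ c (prime∧∤⇒coprime pp p∤m)))
  split : ∀ k → totative (p * m) k + excluded k ≡ totative m k
  split k with p ∣? k
  ... | no  p∤k = trans (+-identityʳ _) (indicator-cong (coprime? k (p * m)) (coprime? k m)
    (λ c (d∣k , d∣m) → c (d∣k , ∣n⇒∣m*n p d∣m))
    (λ c → Coprimality.sym (coprime-*ˡ (prime∧∤⇒coprime pp p∤k) (Coprimality.sym c))))
  ... | yes p∣k with coprime? k (p * m)
  ...   | yes c = contradiction (c (p∣k , m∣m*n m)) (prime≢1 pp)
  ...   | no  _ = +-identityʳ _

φ-prime : ∀ {p} → Prime p → φ p ≡ p ∸ 1
φ-prime {p} pp = trans (cong φ (sym (*-identityʳ p)))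
  (trans (φ-*-∤ 1 pp (prime≢1 pp ∘ ∣1⇒≡1)) (*-identityʳ (p ∸ 1)))

-- Squarefree numbers

Squarefree : ℕ → Set
Squarefree n = ∀ {p} → Prime p → p * p ∤ n

squarefree-∣ : ∀ {m n} → m ∣ n → Squarefree n → Squarefree m
squarefree-∣ m∣n sf pp pp∣m = sf pp (∣-trans pp∣m m∣n)

squarefree⇒∤cofactor : ∀ {p m} → Squarefree (p * m) → Prime p → p ∤ m
squarefree⇒∤cofactor {p} sf pp p∣m = sf pp (*-monoʳ-∣ p p∣m)

φ-product : ∀ {ps} → All Prime ps → Squarefree (product ps) → φ (product ps) ≡ product (map pred ps)
φ-product []                   _  = refl
φ-product {p ∷ ps} (pp ∷ pps) sf = trans (φ-*-∤ (product ps) pp (squarefree⇒∤cofactor sf pp))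
  (cong ((p ∸ 1) *_) (φ-product pps (squarefree-∣ (n∣m*n p) sf)))

primes-∣⇒product-∣ : ∀ {ps m} → All Prime ps → Squarefree (product ps) → All (_∣ m) ps → product ps ∣ m
primes-∣⇒product-∣ {m = m} []  _  _   = 1∣ m
primes-∣⇒product-∣ {p ∷ ps} {m} (pp ∷ pps) sf (p∣m ∷ ps∣m)
  with primes-∣⇒product-∣ pps (squarefree-∣ (n∣m*n p) sf) ps∣m
... | divides c refl with euclidsLemma c (product ps) pp p∣m
...   | inj₁ p∣c  = *-pres-∣ p∣c ∣-refl
...   | inj₂ p∣ps = contradiction p∣ps (squarefree⇒∤cofactor sf pp)

-- Multiply m by the primes of the cofactor one at a time; each multiplies φ by p or by p - 1.
φ-mono-∣ : ∀ {m n} .{{_ : NonZero n}} → m ∣ n → φ m ∣ φ n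
φ-mono-∣ {m} {n} m∣n@(divides c n≡cm) = subst (λ x → φ m ∣ φ x)
  (sym (trans n≡cm (cong (_* m) (PrimeFactorisation.isFactorisation fac))))
  (go (PrimeFactorisation.factorsPrime fac))
  where
  fac : PrimeFactorisation c
  fac = factorise c {{quotient≢0 m∣n}}
  go : ∀ {ps} → All Prime ps → φ m ∣ φ (product ps * m)
  go []                  = ∣-reflexive (cong φ (sym (*-identityˡ m)))
  go {p ∷ ps} (pp ∷ pps) with p ∣? product ps * m
  ... | yes p∣ = subst (φ m ∣_) (sym (trans (cong φ (*-assoc p (product ps) m)) (φ-*-∣ _ pp p∣))) (∣n⇒∣m*n p (go pps))
  ... | no  p∤ = subst (φ m ∣_) (sym (trans (cong φ (*-assoc p (product ps) m)) (φ-*-∤ _ pp p∤))) (∣n⇒∣m*n (p ∸ 1) (go pps))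

prime∣⇒pred∣φ : ∀ {p n} .{{_ : NonZero n}} → Prime p → p ∣ n → p ∸ 1 ∣ φ n
prime∣⇒pred∣φ {n = n} pp p∣n = subst (_∣ φ n) (φ-prime pp) (φ-mono-∣ p∣n)

-- Turns a comparison of sizes into a new prime: a squarefree m larger than n ≥ 1 cannot divide n,
-- and the failure is visible at a single prime.
∃prime∣∤ : ∀ {m n} .{{_ : NonZero m}} → Squarefree m → m ∤ n → ∃[ p ] Prime p × p ∣ m × p ∤ n
∃prime∣∤ {m} {n} sf m∤n with go (PrimeFactorisation.factorsPrime fac)
  where
  fac : PrimeFactorisation m
  fac = factorise m
  go : ∀ {ps} → All Prime ps → All (_∣ n) ps ⊎ (∃[ p ] Prime p × p ∣ product ps × p ∤ n)
  go []                 = inj₁ []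
  go {p ∷ ps} (pp ∷ pps) with p ∣? n | go pps
  ... | no p∤n  | _                        = inj₂ (p , pp , m∣m*n _ , p∤n)
  ... | yes p∣n | inj₁ all                 = inj₁ (p∣n ∷ all)
  ... | yes p∣n | inj₂ (q , pq , q∣ , q∤n) = inj₂ (q , pq , ∣n⇒∣m*n p q∣ , q∤n)
... | inj₁ all = contradiction
  (subst (_∣ n) (sym eq) (primes-∣⇒product-∣ (PrimeFactorisation.factorsPrime (factorise m)) (λ pp pp∣ → sf pp (subst (_ ∣_) (sym eq) pp∣)) all)) m∤n
  where
  eq : m ≡ product (factors (factorise m))
  eq = PrimeFactorisation.isFactorisation (factorise m)
... | inj₂ (p , pp , p∣ , p∤n) = p , pp , subst (p ∣_) (sym (PrimeFactorisation.isFactorisation (factorise m))) p∣ , p∤n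

∃prime∣ : ∀ {n} → 2 ≤ n → ∃[ p ] Prime p × p ∣ n
∃prime∣ {n@(suc _)} 2≤n with factorise n
... | record { factors = [] ; isFactorisation = refl } with 2≤n
...   | s≤s ()
∃prime∣ {n@(suc _)} 2≤n | record { factors = p ∷ ps ; isFactorisation = eq ; factorsPrime = pp ∷ _ } =
  p , pp , subst (p ∣_) (sym eq) (m∣m*n _)

-- If p² ∣ n, then p ∣ φ n ∣ n - 1 although p ∣ n.
φ∣pred⇒squarefree : ∀ {n} .{{_ : NonZero n}} → φ n ∣ n ∸ 1 → Squarefree n
φ∣pred⇒squarefree {n@(suc n-1)} φ∣ {p} pp (divides c n≡) = prime≢1 pp (∣1⇒≡1 (∣m+n∣m⇒∣n
  (subst (p ∣_) (trans n≡ppc (+-comm 1 n-1)) (m∣m*n (p * c)))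
  (∣-trans (subst (p ∣_) (sym φn≡) (m∣m*n _)) φ∣)))
  where
  lemma : ∀ c p → p * (p * c) ≡ c * (p * p)
  lemma = solve-∀
  n≡ppc : p * (p * c) ≡ n
  n≡ppc = trans (lemma c p) (sym n≡)
  φn≡ : φ n ≡ p * φ (p * c)
  φn≡ = trans (cong φ (sym n≡ppc)) (φ-*-∣ (p * c) pp (m∣m*n c))

-- Congruences modulo prime powers

2≤^ : ∀ {g n} → 2 ≤ g → 1 ≤ n → 2 ≤ g ^ n
2≤^ {g} {suc n} 2≤g _ = ≤-trans 2≤g (m≤m*n g (g ^ n) {{m^n≢0 g n {{>-nonZero (<-trans z<s 2≤g)}}}})

-- x^q - 1 is x - 1 times a geometric sum, and this sum is ≡ q modulo m, hence divisible by q.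
^-≡1-lift : ∀ {q m x} → q ∣ m → x ≡1[ m ] → x ^ q ≡1[ m * q ]
^-≡1-lift {q} {m} q∣m (t , refl) with geom-mod (t * m) q
... | u , eq with ∣m∣n⇒∣m+n (∣-refl {q}) (∣n⇒∣m*n u (∣n⇒∣m*n t q∣m))
...   | divides v eq′ = v * t , trans (geom-^ (t * m) q) (cong suc (trans (cong (_* (t * m)) (trans eq eq′)) (lemma v q t m)))
  where
  lemma : ∀ v q t m → v * q * (t * m) ≡ v * t * (m * q)
  lemma = solve-∀

^-≡1-prime-power : ∀ {q x} j → x ≡1[ q ] → x ^ (q ^ j) ≡1[ q ^ suc j ]
^-≡1-prime-power {q} {x} zero    x≡1 = subst₂ _≡1[_] (sym (*-identityʳ x)) (sym (*-identityʳ q)) x≡1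
^-≡1-prime-power {q} {x} (suc j) x≡1 = subst₂ _≡1[_]
  (trans (^-*-assoc x (q ^ j) q) (cong (x ^_) (*-comm (q ^ j) q))) (*-comm (q ^ suc j) q)
  (^-≡1-lift {q} {q ^ suc j} {x ^ (q ^ j)} (m∣m*n (q ^ j)) (^-≡1-prime-power j x≡1))

-- Prime divisors of a Lehmer repunit

module LehmerRepunit {g n : ℕ} (2≤g : 2 ≤ g) (2≤n : 2 ≤ n) (φ∣ : φ (geom g n) ∣ geom g n ∸ 1) where

  private instance
    g≢0 : NonZero g
    g≢0 = >-nonZero (<-trans z<s 2≤g)
    n≢0 : NonZero n
    n≢0 = >-nonZero (<-trans z<s 2≤n)

  N≢0 : NonZero (geom g n)
  N≢0 = >-nonZero (<-trans z<s (≤-<-trans 2≤n (geom-> n 2≤n 2≤g)))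

  squarefree : Squarefree (geom g n)
  squarefree = φ∣pred⇒squarefree {{N≢0}} φ∣

  exponent-factor≥1 : ∀ {d} → d ∣ n → 1 ≤ d
  exponent-factor≥1 {zero}  0∣n = contradiction (0∣⇒≡0 0∣n) (≢-nonZero⁻¹ n)
  exponent-factor≥1 {suc d} _   = s≤s z≤n

  cyclotomic∣ : ∀ f q → f * q ∣ n → geom (g ^ f) q ∣ geom g n
  cyclotomic∣ f q fq∣n = ∣-trans (subst (geom (g ^ f) q ∣_) (sym (geom-* g f q)) (n∣m*n (geom g f))) (geom-∣ g fq∣n)

  -- With n = f q, the divisor B of N exceeds q and is squarefree, so it has a prime factor p ≠ q.
  -- Modulo p the power g^f has order q, whence q ∣ p - 1 ∣ φ(N) ∣ N - 1.
  prime∣exponent⇒∣pred : ∀ {q} → Prime q → q ∣ n → q ∣ geom g n ∸ 1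
  prime∣exponent⇒∣pred {q} pq q∣n@(divides f n≡fq) = from-prime other-prime
    where
    f≥1 : 1 ≤ f
    f≥1 = exponent-factor≥1 (divides q (trans n≡fq (*-comm f q)))
    B = geom (g ^ f) q
    B∣N : B ∣ geom g n
    B∣N = cyclotomic∣ f q (∣-reflexive (sym n≡fq))
    B>q : q < B
    B>q = geom-> q (prime⇒2≤ pq) (2≤^ 2≤g f≥1)
    other-prime : ∃[ p ] Prime p × p ∣ B × p ≢ q
    other-prime with q ∣? B
    ... | no q∤B with ∃prime∣ (<-trans (prime⇒2≤ pq) B>q)
    ...   | p , pp , p∣B = p , pp , p∣B , λ { refl → q∤B p∣B }
    other-prime | yes (divides zero B≡0) = contradiction (subst (q <_) B≡0 B>q) λ ()
    other-prime | yes (divides 1 B≡q) = contradiction (trans B≡q (*-identityˡ q)) (>⇒≢ B>q)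
    other-prime | yes (divides c@(suc (suc _)) B≡cq) with ∃prime∣ {c} (s≤s (s≤s z≤n))
    ...   | p , pp , p∣c = p , pp , subst (p ∣_) (sym B≡cq) (∣m⇒∣m*n q p∣c) ,
      λ { refl → squarefree pq (∣-trans (subst (p * p ∣_) (sym B≡cq) (*-monoˡ-∣ p p∣c)) B∣N) }
    from-prime : (∃[ p ] Prime p × p ∣ B × p ≢ q) → q ∣ geom g n ∸ 1
    from-prime (p , pp , p∣B , p≢q) = ∣-trans (∣geom⇒∣pred f pp pq p≢q p∣B)
      (∣-trans (prime∣⇒pred∣φ {{N≢0}} pp (∣-trans p∣B B∣N)) φ∣)

  -- Otherwise p would divide both N and N - 1.
  prime∣⇒∤exponent : ∀ {p} → Prime p → p ∣ geom g n → p ∤ n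
  prime∣⇒∤exponent {p} pp p∣N p∣n = prime≢1 pp (∣1⇒≡1 (∣m+n∣m⇒∣n {m = geom g n ∸ 1}
    (subst (p ∣_) (sym (m∸n+n≡m {geom g n} (>-nonZero⁻¹ (geom g n) {{N≢0}}))) p∣N)
    (prime∣exponent⇒∣pred pp p∣n)))

  -- `rs` lists the multipliers of the chain, newest first. B exceeds Bₑ and is squarefree, so it
  -- has a prime p ∤ Bₑ. This p does not divide geom g (q e), satisfies q ∣ p - 1, and occurs to the
  -- first power only, so φ gains the factor p - 1 on top of what geom g (q e) contributes.
  prime-power∣φ : ∀ {q} → Prime q → ∀ rs → All (2 ≤_) rs → q * product rs ∣ n →
                  q ^ suc (length rs) ∣ φ (geom g (q * product rs))
  prime-power∣φ {q} pq [] [] q1∣n with ∃prime∣ {geom (g ^ 1) q} (<-trans (prime⇒2≤ pq) (geom-> q (prime⇒2≤ pq) (2≤^ 2≤g (s≤s (z≤n {0})))))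
  ... | p , pp , p∣B = subst₂ _∣_ (sym (*-identityʳ q)) refl
    (∣-trans (∣geom⇒∣pred 1 pp pq p≢q p∣B) (prime∣⇒pred∣φ {{nz}} pp p∣B′))
    where
    1q∣n : 1 * q ∣ n
    1q∣n = subst (_∣ n) (*-comm q 1) q1∣n
    p∣B′ : p ∣ geom g (q * 1)
    p∣B′ = subst (p ∣_) (trans (sym (*-identityˡ _)) (trans (sym (trans (geom-* g 1 q) (cong (_* geom (g ^ 1) q) (geom-1 g)))) (cong (geom g) (*-comm 1 q)))) p∣B
    p≢q : p ≢ q
    p≢q refl = prime∣⇒∤exponent pp (∣-trans p∣B (cyclotomic∣ 1 q 1q∣n)) (∣-trans (m∣m*n 1) q1∣n)
    nz : NonZero (geom g (q * 1))
    nz = >-nonZero (geom≥1 g (exponent-factor≥1 q1∣n))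
  prime-power∣φ {q} pq (r ∷ rs) (2≤r ∷ 2≤rs) qre∣n = extend new
    where
    e = product rs
    qe∣qre : q * e ∣ q * (r * e)
    qe∣qre = *-monoʳ-∣ q (n∣m*n r)
    q∣n : q ∣ n
    q∣n = ∣-trans (m∣m*n (r * e)) qre∣n
    e≥1 : 1 ≤ e
    e≥1 = exponent-factor≥1 (∣-trans (n∣m*n q) (∣-trans qe∣qre qre∣n))
    B = geom (g ^ (r * e)) q
    B∣N : B ∣ geom g n
    B∣N = cyclotomic∣ (r * e) q (subst (_∣ n) (*-comm q (r * e)) qre∣n)
    e<re : e < r * e
    e<re = subst (_< r * e) (*-identityˡ e) (*-monoˡ-< e {{>-nonZero e≥1}} 2≤r)
    Bₑ = geom (g ^ e) q
    Bₑ<B : Bₑ < B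
    Bₑ<B = geom-mono-< q (prime⇒2≤ pq) (^-monoʳ-< g 2≤g e<re)
    Bₑ≢0 : NonZero Bₑ
    Bₑ≢0 = >-nonZero (<-trans z<s (<-trans (prime⇒2≤ pq) (geom-> q (prime⇒2≤ pq) (2≤^ 2≤g e≥1))))
    new : ∃[ p ] Prime p × p ∣ B × p ∤ Bₑ
    new = ∃prime∣∤ {{>-nonZero (≤-<-trans z≤n Bₑ<B)}} (squarefree-∣ B∣N squarefree)
      (λ B∣Bₑ → <⇒≱ Bₑ<B (∣⇒≤ {{Bₑ≢0}} B∣Bₑ))
    Nₒ = geom g (q * e)
    extend : (∃[ p ] Prime p × p ∣ B × p ∤ Bₑ) → q ^ suc (suc (length rs)) ∣ φ (geom g (q * (r * e)))
    extend (p , pp , p∣B , p∤Bₑ) = result (geom-∣ g qe∣qre)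
      where
      p≢q : p ≢ q
      p≢q refl = prime∣⇒∤exponent pp (∣-trans p∣B B∣N) q∣n
      -- p ∣ geom g e would give g^(r e) ≡ 1, hence B ≡ q modulo p, hence p = q.
      p∤Nₑ : p ∤ geom g e
      p∤Nₑ p∣Nₑ = p≢q (prime-∣-prime pp pq (∣geom∧≡1⇒∣exponent q p∣B (≡1-^-* r e (∣geom⇒≡1 g e p∣Nₑ))))
      p∤Nₒ : p ∤ Nₒ
      p∤Nₒ p∣Nₒ with euclidsLemma (geom g e) Bₑ pp (subst (p ∣_) (trans (cong (geom g) (*-comm q e)) (geom-* g e q)) p∣Nₒ)
      ... | inj₁ p∣Nₑ = p∤Nₑ p∣Nₑ
      ... | inj₂ p∣Bₑ = p∤Bₑ p∣Bₑ
      p∣N′ : p ∣ geom g (q * (r * e))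
      p∣N′ = ∣-trans p∣B (subst (B ∣_) (trans (sym (geom-* g (r * e) q)) (cong (geom g) (*-comm (r * e) q))) (n∣m*n (geom g (r * e))))
      result : Nₒ ∣ geom g (q * (r * e)) → q ^ suc (suc (length rs)) ∣ φ (geom g (q * (r * e)))
      result (divides c′ N′≡) with euclidsLemma c′ Nₒ pp (subst (p ∣_) N′≡ p∣N′)
      ... | inj₂ p∣Nₒ = contradiction p∣Nₒ p∤Nₒ
      ... | inj₁ (divides c refl) = subst (λ x → q ^ suc (suc (length rs)) ∣ φ x) (sym N′≡p)
        (subst (q ^ suc (suc (length rs)) ∣_) (sym (φ-*-∤ (c * Nₒ) pp p∤cNₒ))
          (*-pres-∣ (∣geom⇒∣pred (r * e) pp pq p≢q p∣B)
            (∣-trans (prime-power∣φ pq rs 2≤rs (∣-trans qe∣qre qre∣n)) (φ-mono-∣ {{cNₒ≢0}} (n∣m*n c)))))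
        where
        lemma : ∀ c p m → c * p * m ≡ p * (c * m)
        lemma = solve-∀
        N′≡p : geom g (q * (r * e)) ≡ p * (c * Nₒ)
        N′≡p = trans N′≡ (lemma c p Nₒ)
        N′∣N : p * (c * Nₒ) ∣ geom g n
        N′∣N = subst (_∣ geom g n) N′≡p (geom-∣ g qre∣n)
        p∤cNₒ : p ∤ c * Nₒ
        p∤cNₒ = squarefree⇒∤cofactor (squarefree-∣ N′∣N squarefree) pp
        cNₒ≢0 : NonZero (c * Nₒ)
        cNₒ≢0 = ∤⇒nonZero p∤cNₒ

  -- N - 1 = g · geom g m with n = m + 1. If q ∣ g, the sum is prime to q and q^j ∣ g. Otherwise g^m
  -- ≡ 1 modulo q^j. Then x = g^(q-1) satisfies x^m ≡ 1 and, by Fermat and lifting, x^(q^j) ≡ 1; as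
  -- q ∤ m, already x ≡ 1 modulo q^j.
  prime-power-≤ : ∀ {q} j → Prime q → q ∣ n → q ^ j ∣ geom g n ∸ 1 → q ^ j ≤ g ^ q
  prime-power-≤ {q} j pq q∣n qʲ∣ = bound n refl q∣n qʲ∣
    where
    q-1≥1 : 1 ≤ q ∸ 1
    q-1≥1 = m<n⇒0<n∸m (prime⇒2≤ pq)
    bound : ∀ m → m ≡ n → q ∣ m → q ^ j ∣ geom g m ∸ 1 → q ^ j ≤ g ^ q
    bound zero    0≡n _     _  = contradiction (sym 0≡n) (≢-nonZero⁻¹ n)
    bound (suc m) sm≡n q∣sm qʲ∣ with q ∣? g
    ... | yes q∣g = ≤-trans
      (∣⇒≤ (coprime-divisor (coprime-^ˡ j (prime∧∤⇒coprime pq q∤geom)) (subst (q ^ j ∣_) (*-comm g (geom g m)) qʲ∣)))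
      (subst (_≤ g ^ q) (*-identityʳ g) (^-monoʳ-≤ g (≤-trans (s≤s z≤n) (prime⇒2≤ pq))))
      where
      q∤geom : q ∤ geom g m
      q∤geom q∣geom = ∣geom⇒∤base m (prime≢1 pq) q∣geom (s≤s⁻¹ (subst (2 ≤_) (sym sm≡n) 2≤n)) q∣g
    ... | no q∤g = ≤-trans (∣⇒≤pred (≡1⇒∣pred x≡1)) (≤-trans pred[n]≤n (^-monoʳ-≤ g (m∸n≤m q 1)))
      where
      x = g ^ (q ∸ 1)
      instance
        x≢0 : NonZero x
        x≢0 = m^n≢0 g (q ∸ 1)
      ∣⇒≤pred : q ^ j ∣ pred x → q ^ j ≤ pred x
      ∣⇒≤pred = ∣⇒≤ {{>-nonZero (m<n⇒0<n∸m (2≤^ 2≤g q-1≥1))}}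
      q∤m : q ∤ m
      q∤m q∣m = prime≢1 pq (∣1⇒≡1 (∣m+n∣m⇒∣n (subst (q ∣_) (+-comm 1 m) q∣sm) q∣m))
      g^m≡1 : g ^ m ≡1[ q ^ j ]
      g^m≡1 = ∣geom⇒≡1 g m (coprime-divisor (coprime-^ˡ j (prime∧∤⇒coprime pq q∤g)) qʲ∣)
      x≡1 : x ≡1[ q ^ j ]
      x≡1 = ≡1-coprime-exponents x (Coprimality.sym (coprime-^ˡ j (prime∧∤⇒coprime pq q∤m)))
        (subst (_≡1[ q ^ j ]) (trans (^-*-assoc g m (q ∸ 1)) (trans (cong (g ^_) (*-comm m (q ∸ 1))) (sym (^-*-assoc g (q ∸ 1) m))))
          (≡1-^ (q ∸ 1) g^m≡1))
        (weaken (^-≡1-prime-power j (fermat-unit pq q∤g)))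
        where
        weaken : ∀ {y} → y ≡1[ q * q ^ j ] → y ≡1[ q ^ j ]
        weaken (t , eq) = t * q , trans eq (cong suc (sym (*-assoc t q (q ^ j))))

-- Nielsen's bound for products close to a fraction

^-distribʳ-* : ∀ n x y → (x * y) ^ n ≡ x ^ n * y ^ n
^-distribʳ-* zero    x y = refl
^-distribʳ-* (suc n) x y = trans (cong (x * y *_) (^-distribʳ-* n x y)) (lemma x y (x ^ n) (y ^ n))
  where
  lemma : ∀ a b c d → a * b * (c * d) ≡ a * c * (b * d)
  lemma = solve-∀

product-pred : List ℕ → ℕ
product-pred xs = product (map pred xs)

product-pred-++ : ∀ xs ys → product-pred (xs ++ ys) ≡ product-pred xs * product-pred ys
product-pred-++ xs ys = trans (cong product (map-++ pred xs ys)) (product-++ (map pred xs) (map pred ys))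

product-pred-≤ : ∀ xs → product-pred xs ≤ product xs
product-pred-≤ []       = ≤-refl
product-pred-≤ (x ∷ xs) = *-mono-≤ (pred[n]≤n {x}) (product-pred-≤ xs)

product-≥1 : ∀ {xs} → All (1 ≤_) xs → 1 ≤ product xs
product-≥1 []           = ≤-refl
product-≥1 (1≤x ∷ 1≤xs) = *-mono-≤ 1≤x (product-≥1 1≤xs)

product-≤-^ : ∀ {b xs} → All (_≤ b) xs → product xs ≤ b ^ length xs
product-≤-^ []           = ≤-refl
product-≤-^ (x≤b ∷ xs≤b) = *-mono-≤ x≤b (product-≤-^ xs≤b)

AllPairs-++⁻ʳ : ∀ {R : ℕ → ℕ → Set} xs {ys} → AllPairs R (xs ++ ys) → AllPairs R ys
AllPairs-++⁻ʳ []       Rys       = Rys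
AllPairs-++⁻ʳ (_ ∷ xs) (_ ∷ Rxs) = AllPairs-++⁻ʳ xs Rxs

-- Nonempty by construction, so that removing the prefix shortens the list; the threshold depends on
-- the length of the prefix itself.
record SmallPrefix (y : ℕ) (xs : List ℕ) : Set where
  field
    head    : ℕ
    tail    : List ℕ
    rest    : List ℕ
    split   : xs ≡ head ∷ tail ++ rest
    small   : All (_≤ 2 ^ suc (length tail) * y) (head ∷ tail)

-- If the j-th entry exceeded 2 ^ j * (1 + a) for every j, then the product of the factors 1 - 1/x
-- would exceed 1 - (1/2 + 1/4 + ⋯)/(1 + a) ≥ a/(1 + a).
smallPrefix : ∀ a xs → AllPairs _≤_ xs → suc a * product-pred xs ≤ a * product xs → SmallPrefix (suc a) xs
smallPrefix a []       _               le = contradiction (*-cancelʳ-≤ (suc a) a 1 le) 1+n≰n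
smallPrefix a (x ∷ xs) (x≤xs ∷ sorted) le with x ≤? 2 * suc a
... | yes x≤2y = record { head = x ; tail = [] ; rest = xs ; split = refl ; small = x≤2y ∷ [] }
smallPrefix a (zero  ∷ xs) _               le | no x≰2y = contradiction z≤n x≰2y
smallPrefix a (suc w ∷ xs) (x≤xs ∷ sorted) le | no x≰2y = extend (smallPrefix a′ xs sorted le′)
  where
  open ≤-Reasoning
  -- Dropping x > 2 (1 + a) weakens the fraction a / (1 + a) to a′ / (1 + a′) with 1 + a′ = 2 (1 +
  -- a). In this form `suc a′` is `2 * suc a` by definition.
  a′ = a + suc (a + 0)
  P = product xs
  P′ = product-pred xs
  2y≤w : 2 * suc a ≤ w
  2y≤w = s≤s⁻¹ (≰⇒> x≰2y)
  instance
    w≢0 : NonZero w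
    w≢0 = >-nonZero (<-≤-trans z<s 2y≤w)
  lemma₁ : ∀ a w P′ → w * (2 * suc a * P′) ≡ 2 * (suc a * (w * P′))
  lemma₁ = solve-∀
  lemma₂ : ∀ a w P → 2 * (a * (suc w * P)) ≡ (2 * a + 2 * a * w) * P
  lemma₂ = solve-∀
  lemma₃ : ∀ a w P → (w + 2 * a * w) * P ≡ w * ((a + suc (a + 0)) * P)
  lemma₃ = solve-∀
  le′ : suc a′ * P′ ≤ a′ * P
  le′ = *-cancelˡ-≤ w (begin
    w * (2 * suc a * P′)           ≡⟨ lemma₁ a w P′ ⟩
    2 * (suc a * (w * P′))         ≤⟨ *-monoʳ-≤ 2 le ⟩
    2 * (a * (suc w * P))          ≡⟨ lemma₂ a w P ⟩
    (2 * a + 2 * a * w) * P        ≤⟨ *-monoˡ-≤ P (+-monoˡ-≤ (2 * a * w) (≤-trans (*-monoʳ-≤ 2 (n≤1+n a)) 2y≤w)) ⟩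
    (w + 2 * a * w) * P            ≡⟨ lemma₃ a w P ⟩
    w * (a′ * P)                   ∎)
  extend : SmallPrefix (2 * suc a) xs → SmallPrefix (suc a) (suc w ∷ xs)
  extend record { head = h ; tail = t ; rest = r ; split = refl ; small = h≤ ∷ t≤ } = record
    { head = suc w ; tail = h ∷ t ; rest = r ; split = refl
    ; small = ≤-trans (All.head x≤xs) (subst (h ≤_) eq h≤) ∷ subst (λ b → All (_≤ b) (h ∷ t)) eq (h≤ ∷ t≤) }
    where
    lemma : ∀ k y → k * (2 * y) ≡ 2 * k * y
    lemma = solve-∀
    eq : 2 ^ suc (length t) * (2 * suc a) ≡ 2 ^ suc (suc (length t)) * suc a
    eq = lemma (2 ^ suc (length t)) (suc a)

-- The entries xs bring the fraction b * ∏ (x - 1) / (a * ∏ x) down to at most 1, and no proper prefix does.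
record Admissible (a b : ℕ) (xs : List ℕ) : Set where
  field
    below : ∀ ys z zs → xs ≡ ys ++ z ∷ zs → a * product ys < b * product-pred ys
    above : b * product-pred xs ≤ a * product xs

open Admissible

admissible-drop : ∀ {a b} ys {zs} → Admissible a b (ys ++ zs) → Admissible (a * product ys) (b * product-pred ys) zs
admissible-drop {a} {b} ys {zs} adm = record
  { below = λ { us v vs refl → subst₂ _<_
      (trans (cong (a *_) (product-++ ys us)) (sym (*-assoc a _ _)))
      (trans (cong (b *_) (product-pred-++ ys us)) (sym (*-assoc b _ _)))
      (below adm (ys ++ us) v vs (sym (++-assoc ys us (v ∷ vs)))) }
  ; above = subst₂ _≤_
      (trans (cong (b *_) (product-pred-++ ys zs)) (sym (*-assoc b _ _)))
      (trans (cong (a *_) (product-++ ys zs)) (sym (*-assoc a _ _)))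
      (above adm)
  }

-- The empty prefix gives a < b, so b ≥ 1 + a by integrality, and the final inequality survives with
-- 1 + a in place of b.
admissible⇒smallPrefix : ∀ {a b x xs} → AllPairs _≤_ (x ∷ xs) → Admissible a b (x ∷ xs) → SmallPrefix (suc a) (x ∷ xs)
admissible⇒smallPrefix {a} {b} {x} {xs} sorted adm = smallPrefix a (x ∷ xs) sorted
  (≤-trans (*-monoˡ-≤ (product-pred (x ∷ xs)) a<b) (above adm))
  where
  a<b : a < b
  a<b = subst₂ _<_ (*-identityʳ a) (*-identityʳ b) (below adm [] x xs refl)

prefix-product-bound : ∀ a {ys} → All (1 ≤_) ys → All (_≤ 2 ^ length ys * suc a) ys →
                       2 * suc (a * product ys) ≤ 2 ^ suc (length ys * length ys) * suc a ^ suc (length ys)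
prefix-product-bound a {ys} 1≤ys small = begin
  2 * suc (a * product ys)                    ≤⟨ *-monoʳ-≤ 2 (+-monoˡ-≤ (a * product ys) (product-≥1 1≤ys)) ⟩
  2 * (suc a * product ys)                    ≤⟨ *-monoʳ-≤ 2 (*-monoʳ-≤ (suc a) (product-≤-^ small)) ⟩
  2 * (suc a * (2 ^ j * suc a) ^ j)           ≡⟨ cong (λ z → 2 * (suc a * z)) (^-distribʳ-* j (2 ^ j) (suc a)) ⟩
  2 * (suc a * ((2 ^ j) ^ j * suc a ^ j))     ≡⟨ cong (λ z → 2 * (suc a * (z * suc a ^ j))) (^-*-assoc 2 j j) ⟩
  2 * (suc a * (2 ^ (j * j) * suc a ^ j))     ≡⟨ lemma (suc a) (2 ^ (j * j)) (suc a ^ j) ⟩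
  2 ^ suc (j * j) * suc a ^ suc j             ∎
  where
  open ≤-Reasoning
  j = length ys
  lemma : ∀ x y z → 2 * (x * (y * z)) ≡ 2 * y * (x * z)
  lemma = solve-∀

quadratic≤2^ : ∀ j → j * j + j + 2 ≤ 2 ^ suc j
quadratic≤2^ zero    = ≤-refl
quadratic≤2^ (suc j) = begin
  suc j * suc j + suc j + 2         ≡⟨ lemma₁ j ⟩
  (j * j + j + 2) + (j + j + 2)     ≤⟨ +-monoʳ-≤ (j * j + j + 2) (+-monoˡ-≤ 2 (+-monoˡ-≤ j (j≤j² j))) ⟩
  (j * j + j + 2) + (j * j + j + 2) ≡⟨ lemma₂ (j * j + j + 2) ⟩
  2 * (j * j + j + 2)               ≤⟨ *-monoʳ-≤ 2 (quadratic≤2^ j) ⟩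
  2 * 2 ^ suc j                     ∎
  where
  open ≤-Reasoning
  lemma₁ : ∀ j → suc j * suc j + suc j + 2 ≡ (j * j + j + 2) + (j + j + 2)
  lemma₁ = solve-∀
  lemma₂ : ∀ j → j + j ≡ 2 * j
  lemma₂ = solve-∀
  j≤j² : ∀ j → j ≤ j * j
  j≤j² zero    = z≤n
  j≤j² (suc j) = m≤m*n (suc j) (suc j)

-- The exponent j² + 1 of 2 may exceed 2^j, but then j + 1 falls short of 2^j by enough: since 2 ≤ 1
-- + a, the surplus powers of 2 are traded for missing powers of 1 + a.
block-bound : ∀ j a → 1 ≤ a → 2 ^ suc (j * j) * suc a ^ suc j ≤ (2 * suc a) ^ (2 ^ j)
block-bound j a 1≤a = begin
  2 ^ suc (j * j) * suc a ^ suc j                                ≤⟨ *-monoˡ-≤ _ (^-monoʳ-≤ 2 exponent) ⟩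
  2 ^ (2 ^ j + (2 ^ j ∸ suc j)) * suc a ^ suc j                  ≡⟨ cong (_* suc a ^ suc j) (^-distribˡ-+-* 2 (2 ^ j) (2 ^ j ∸ suc j)) ⟩
  2 ^ (2 ^ j) * 2 ^ (2 ^ j ∸ suc j) * suc a ^ suc j              ≤⟨ *-monoˡ-≤ _ (*-monoʳ-≤ (2 ^ (2 ^ j)) (^-monoˡ-≤ (2 ^ j ∸ suc j) (s≤s 1≤a))) ⟩
  2 ^ (2 ^ j) * suc a ^ (2 ^ j ∸ suc j) * suc a ^ suc j          ≡⟨ *-assoc (2 ^ (2 ^ j)) _ _ ⟩
  2 ^ (2 ^ j) * (suc a ^ (2 ^ j ∸ suc j) * suc a ^ suc j)        ≡⟨ cong (2 ^ (2 ^ j) *_) (^-distribˡ-+-* (suc a) (2 ^ j ∸ suc j) (suc j)) ⟨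
  2 ^ (2 ^ j) * suc a ^ ((2 ^ j ∸ suc j) + suc j)                ≡⟨ cong (λ e → 2 ^ (2 ^ j) * suc a ^ e) (m∸n+n≡m (j<2^ j)) ⟩
  2 ^ (2 ^ j) * suc a ^ (2 ^ j)                                  ≡⟨ ^-distribʳ-* (2 ^ j) 2 (suc a) ⟨
  (2 * suc a) ^ (2 ^ j)                                          ∎
  where
  open ≤-Reasoning
  j<2^ : ∀ j → suc j ≤ 2 ^ j
  j<2^ zero    = ≤-refl
  j<2^ (suc j) = ≤-trans (+-mono-≤ (>-nonZero⁻¹ (2 ^ j) {{m^n≢0 2 j}}) (j<2^ j)) (≤-reflexive (cong (2 ^ j +_) (sym (+-identityʳ (2 ^ j)))))
  exponent : suc (j * j) ≤ 2 ^ j + (2 ^ j ∸ suc j)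
  exponent = +-cancelʳ-≤ (suc j) _ _ (begin
    suc (j * j) + suc j                    ≡⟨ lemma j ⟩
    j * j + j + 2                          ≤⟨ quadratic≤2^ j ⟩
    2 ^ suc j                              ≡⟨ cong (2 ^ j +_) (+-identityʳ (2 ^ j)) ⟩
    2 ^ j + 2 ^ j                          ≡⟨ cong (2 ^ j +_) (m∸n+n≡m (j<2^ j)) ⟨
    2 ^ j + (2 ^ j ∸ suc j + suc j)        ≡⟨ +-assoc (2 ^ j) _ _ ⟨
    2 ^ j + (2 ^ j ∸ suc j) + suc j        ∎)
    where
    lemma : ∀ j → suc (j * j) + suc j ≡ j * j + j + 2
    lemma = solve-∀

-- The quantity 2 (1 + a) is chosen because it iterates: absorbing a block of j entries into a
-- raises it at most to the power 2^j, and these exponents multiply over the blocks.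
growth : ∀ {a b xs} → 1 ≤ a → AllPairs _≤_ xs → All (1 ≤_) xs → Admissible a b xs →
         2 * suc (a * product xs) ≤ (2 * suc a) ^ (2 ^ length xs)
growth {xs = xs} = go (length xs) xs ≤-refl
  where
  go : ∀ k {a b} xs → length xs ≤ k → 1 ≤ a → AllPairs _≤_ xs → All (1 ≤_) xs → Admissible a b xs →
       2 * suc (a * product xs) ≤ (2 * suc a) ^ (2 ^ length xs)
  go _       {a} []           _       _   _      _    _   = ≤-reflexive (trans (cong (λ z → 2 * suc z) (*-identityʳ a)) (sym (*-identityʳ _)))
  go (suc k) {a} xs@(_ ∷ _) (s≤s ≤k) 1≤a sorted 1≤xs adm with admissible⇒smallPrefix sorted adm
  ... | record { head = h ; tail = t ; rest = r ; split = refl ; small = small } = begin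
    2 * suc (a * product (h ∷ t ++ r))                  ≡⟨ cong (λ z → 2 * suc z) (trans (cong (a *_) (product-++ (h ∷ t) r)) (sym (*-assoc a _ _))) ⟩
    2 * suc (a * product (h ∷ t) * product r)           ≤⟨ go k r (≤-trans (m≤n+m (length r) (length t)) (≤-trans (≤-reflexive (sym (length-++ t))) ≤k))
                                                             (*-mono-≤ 1≤a (product-≥1 (All-++⁻ˡ (h ∷ t) 1≤xs))) (AllPairs-++⁻ʳ (h ∷ t) sorted)
                                                             (All-++⁻ʳ (h ∷ t) 1≤xs) (admissible-drop (h ∷ t) adm) ⟩
    (2 * suc (a * product (h ∷ t))) ^ (2 ^ length r)    ≤⟨ ^-monoˡ-≤ (2 ^ length r) (≤-trans (prefix-product-bound a (All-++⁻ˡ (h ∷ t) 1≤xs) small) (block-bound (suc (length t)) a 1≤a)) ⟩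
    ((2 * suc a) ^ (2 ^ suc (length t))) ^ (2 ^ length r) ≡⟨ ^-*-assoc (2 * suc a) (2 ^ suc (length t)) (2 ^ length r) ⟩
    (2 * suc a) ^ (2 ^ suc (length t) * 2 ^ length r)   ≡⟨ cong ((2 * suc a) ^_) (^-distribˡ-+-* 2 (suc (length t)) (length r)) ⟨
    (2 * suc a) ^ (2 ^ (suc (length t) + length r))     ≡⟨ cong (λ z → (2 * suc a) ^ (2 ^ suc z)) (length-++ t) ⟨
    (2 * suc a) ^ (2 ^ length (h ∷ t ++ r))             ∎
    where open ≤-Reasoning

-- Equality is excluded by parity, and the reverse inequality by the 1 in N ≡ 1 + m * φ N.
lehmer-below : ∀ {m} ys z zs → 2 ≤ m → All (λ y → 2 ∣ pred y) ys → 2 ∤ product ys → All (2 ≤_) (z ∷ zs) →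
               product ys * product (z ∷ zs) ≡ 1 + m * (product-pred ys * product-pred (z ∷ zs)) →
               product ys < m * product-pred ys
lehmer-below {m} ys z zs 2≤m even odd (2≤z ∷ 2≤zs) eq with <-cmp (product ys) (m * product-pred ys)
... | tri< lt _ _ = lt
... | tri≈ _ e  _ = contradiction e (unequal ys even odd)
  where
  unequal : ∀ ys → All (λ y → 2 ∣ pred y) ys → 2 ∤ product ys → product ys ≢ m * product-pred ys
  unequal []       _          _   e = <⇒≢ 2≤m (trans e (*-identityʳ m))
  unequal (y ∷ ys) (2∣ ∷ _) odd e = odd (subst (2 ∣_) (sym e) (∣n⇒∣m*n m (∣m⇒∣m*n _ 2∣)))
... | tri> _ _ gt = contradiction (+-cancelʳ-≤ (m * product-pred ys * R) R 1 (begin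
    R + m * product-pred ys * R                       ≤⟨ *-monoˡ-≤ R gt ⟩
    product ys * R                                    ≡⟨ eq ⟩
    1 + m * (product-pred ys * product-pred (z ∷ zs)) ≤⟨ s≤s (*-monoʳ-≤ m (*-monoʳ-≤ (product-pred ys) (product-pred-≤ (z ∷ zs)))) ⟩
    1 + m * (product-pred ys * R)                     ≡⟨ cong suc (sym (*-assoc m (product-pred ys) R)) ⟩
    1 + m * product-pred ys * R                       ∎)) (<⇒≱ 2≤R)
  where
  open ≤-Reasoning
  R = product (z ∷ zs)
  2≤R : 2 ≤ R
  2≤R = *-mono-≤ 2≤z (product-≥1 (All.map (≤-trans (s≤s z≤n)) 2≤zs))

-- The factorisation of a Lehmer number

2∤⇒2∣pred : ∀ {n} → 2 ∤ n → 2 ∣ pred n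
2∤⇒2∣pred {zero}        2∤n = contradiction (2 ∣0) 2∤n
2∤⇒2∣pred {1}           _   = 2 ∣0
2∤⇒2∣pred {suc (suc n)} 2∤n = lift n (2∤⇒2∣pred {n} (2∤n ∘ ∣m∣n⇒∣m+n ∣-refl))
  (2∤n ∘ λ 2∣n → ∣m∣n⇒∣m+n ∣-refl 2∣n)
  where
  lift : ∀ n → 2 ∣ pred n → 2 ∤ n → 2 ∣ suc n
  lift zero    _  2∤0 = contradiction (2 ∣0) 2∤0
  lift (suc n) 2∣ _   = ∣m∣n⇒∣m+n ∣-refl 2∣

record LehmerFactorisation (N : ℕ) : Set where
  field
    primes     : List ℕ
    multiple   : ℕ
    sorted     : AllPairs _≤_ primes
    allPrime   : All Prime primes
    allEven    : All (λ p → 2 ∣ pred p) primes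
    2≤multiple : 2 ≤ multiple
    odd        : 2 ∤ N
    product≡   : product primes ≡ N
    N≡         : N ≡ 1 + multiple * product-pred primes

lehmerFactorisation : ∀ {N} → Lehmer N → LehmerFactorisation N
lehmerFactorisation {N} (comp , φ∣) = build ps refl
  where
  instance
    N≢0 : NonZero N
    N≢0 = composite⇒nonZero comp
  1<N : 1 < N
  1<N = nonTrivial⇒n>1 N {{composite⇒nonTrivial comp}}
  sf : Squarefree N
  sf = φ∣pred⇒squarefree φ∣
  ps : List ℕ
  ps = sort (factors (factorise N))
  product-ps : product ps ≡ N
  product-ps = trans (product-↭ (sort-↭ (factors (factorise N)))) (sym (PrimeFactorisation.isFactorisation (factorise N)))
  prime-ps : All Prime ps
  prime-ps = All-resp-↭ (↭-sym (sort-↭ (factors (factorise N)))) (PrimeFactorisation.factorsPrime (factorise N))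
  φN≡ : φ N ≡ product-pred ps
  φN≡ = trans (cong φ (sym product-ps)) (φ-product prime-ps (subst Squarefree (sym product-ps) sf))
  m = quotient φ∣
  N≡1+mφ : N ≡ 1 + m * product-pred ps
  N≡1+mφ = trans (sym (m+[n∸m]≡n (<⇒≤ 1<N))) (cong suc (trans (_∣_.equality φ∣) (cong (m *_) φN≡)))
  -- An odd prime factor p makes p - 1, hence φ(N) and N - 1, even. Squarefreeness supplies one: two
  -- prime factors cannot both be 2.
  odd-if : ∀ {p} → Prime p → p ∣ N → 2 ≢ p → 2 ∤ N
  odd-if {p} pp p∣N 2≢p 2∣N = prime≢1 prime[2] (∣1⇒≡1 (∣m+n∣m⇒∣n (subst (2 ∣_) (sym (m∸n+n≡m (<⇒≤ 1<N))) 2∣N)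
    (∣-trans (2∤⇒2∣pred (2≢p ∘ prime-∣-prime prime[2] pp)) (∣-trans (prime∣⇒pred∣φ pp p∣N) φ∣))))
  two-factors : ∀ p p′ rs → All Prime (p ∷ p′ ∷ rs) → product (p ∷ p′ ∷ rs) ≡ N → N ≡ 1 + m * product-pred (p ∷ p′ ∷ rs) → 2 ≤ m × 2 ∤ N
  two-factors p p′ rs (pp ∷ pp′ ∷ prs) product≡N N≡ = 2≤m m refl , N-odd
    where
    N-odd : 2 ∤ N
    N-odd with 2 ≟ p | 2 ≟ p′
    ... | no 2≢p   | _        = odd-if pp (subst (p ∣_) product≡N (m∣m*n _)) 2≢p
    ... | yes _    | no 2≢p′  = odd-if pp′ (subst (p′ ∣_) product≡N (∣n⇒∣m*n p (m∣m*n _))) 2≢p′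
    ... | yes refl | yes refl = contradiction (subst (2 * 2 ∣_) product≡N (*-monoʳ-∣ 2 (m∣m*n {2} (product rs)))) (sf prime[2])
    R = product (p′ ∷ rs)
    2≤R : 2 ≤ R
    2≤R = *-mono-≤ (prime⇒2≤ pp′) (product-≥1 (All.map (≤-trans (s≤s z≤n) ∘ prime⇒2≤) prs))
    -- m = 0 would give N = 1, and m = 1 would give p R ≤ 1 + (p - 1) R, that is R ≤ 1.
    2≤m : ∀ k → k ≡ m → 2 ≤ k
    2≤m 0 refl = contradiction 1<N (<⇒≱ (subst (_< 2) (sym N≡) (s≤s (s≤s z≤n))))
    2≤m 1 refl = contradiction (+-cancelʳ-≤ ((p ∸ 1) * R) R 1 (begin
      R + (p ∸ 1) * R                       ≡⟨⟩
      suc (p ∸ 1) * R                       ≡⟨ cong (_* R) (m+[n∸m]≡n (<⇒≤ (prime⇒2≤ pp))) ⟩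
      p * R                                 ≡⟨ product≡N ⟩
      N                                     ≡⟨ N≡ ⟩
      1 + 1 * ((p ∸ 1) * product-pred (p′ ∷ rs)) ≡⟨ cong suc (*-identityˡ _) ⟩
      1 + (p ∸ 1) * product-pred (p′ ∷ rs)  ≤⟨ s≤s (*-monoʳ-≤ (p ∸ 1) (product-pred-≤ (p′ ∷ rs))) ⟩
      1 + (p ∸ 1) * R                       ∎)) (<⇒≱ 2≤R)
      where open ≤-Reasoning
    2≤m (suc (suc _)) _ = s≤s (s≤s z≤n)
  build : ∀ qs → ps ≡ qs → LehmerFactorisation N
  build [] eq = contradiction (trans (cong product (sym eq)) product-ps) (<⇒≢ 1<N)
  build (p ∷ []) eq = contradiction
    (subst Prime (trans (sym (*-identityʳ p)) (trans (cong product (sym eq)) product-ps)) (All.head (subst (All Prime) eq prime-ps)))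
    (composite⇒¬prime comp)
  build (p ∷ p′ ∷ rs) eq = record
    { primes     = ps
    ; multiple   = m
    ; sorted     = Linked⇒AllPairs ≤-trans (sort-↗ (factors (factorise N)))
    ; allPrime   = prime-ps
    ; allEven    = even prime-ps (λ p∣ → subst (_ ∣_) product-ps p∣)
    ; 2≤multiple = proj₁ facts
    ; odd        = proj₂ facts
    ; product≡   = product-ps
    ; N≡         = N≡1+mφ
    }
    where
    facts : 2 ≤ m × 2 ∤ N
    facts = two-factors p p′ rs (subst (All Prime) eq prime-ps) (trans (cong product (sym eq)) product-ps)
      (trans N≡1+mφ (cong (λ xs → 1 + m * product-pred xs) eq))
    even : ∀ {qs} → All Prime qs → (∀ {q} → q ∣ product qs → q ∣ N) → All (λ q → 2 ∣ pred q) qs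
    even []                 _  = []
    even {q ∷ qs} (_ ∷ pqs) ∣N = 2∤⇒2∣pred {q} (λ 2∣q → proj₂ facts (∣-trans 2∣q (∣N (m∣m*n (product qs))))) ∷ even pqs (∣N ∘ ∣n⇒∣m*n q)

-- Order is kept on the right only: the left part will enter through its product alone.
record Separation (D : ℕ → Set) (xs : List ℕ) : Set where
  field
    left right  : List ℕ
    permutation : left ++ right ↭ xs
    left-holds  : All D left
    right-fails : All (¬_ ∘ D) right
    right-sorted : AllPairs _≤_ right

separate : ∀ {D : ℕ → Set} (D? : ∀ x → Dec (D x)) xs → AllPairs _≤_ xs → Separation D xs
separate D? []       _               = record
  { left = [] ; right = [] ; permutation = ↭-refl ; left-holds = [] ; right-fails = [] ; right-sorted = [] }
separate D? (x ∷ xs) (x≤xs ∷ sorted) with D? x | separate D? xs sorted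
... | yes Dx | record { left = l ; right = r ; permutation = perm ; left-holds = Dl ; right-fails = ¬Dr ; right-sorted = s } = record
  { left = x ∷ l ; right = r ; permutation = prep x perm ; left-holds = Dx ∷ Dl ; right-fails = ¬Dr ; right-sorted = s }
... | no ¬Dx | record { left = l ; right = r ; permutation = perm ; left-holds = Dl ; right-fails = ¬Dr ; right-sorted = s } = record
  { left = l ; right = x ∷ r ; permutation = ↭-trans (shift x l r) (prep x perm) ; left-holds = Dl ; right-fails = ¬Dx ∷ ¬Dr
  ; right-sorted = All-++⁻ʳ l (All-resp-↭ (↭-sym perm) x≤xs) ∷ s }

module _ {N : ℕ} (fac : LehmerFactorisation N) where
  open LehmerFactorisation fac

  -- `lehmer-below` is indifferent to the order of the primes, so any selection `ls` may come first
  -- and be absorbed into the starting fraction.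
  lehmer-admissible : ∀ ls rs → ls ++ rs ↭ primes → Admissible (product ls) (multiple * product-pred ls) rs
  lehmer-admissible ls rs perm = record
    { below = λ { ys z zs refl → subst₂ _<_
        (product-++ ls ys) (trans (cong (multiple *_) (product-pred-++ ls ys)) (sym (*-assoc multiple _ _)))
        (below′ ys z zs (subst (_↭ primes) (sym (++-assoc ls ys (z ∷ zs))) perm)) }
    ; above = begin
        multiple * product-pred ls * product-pred rs ≡⟨ *-assoc multiple _ _ ⟩
        multiple * (product-pred ls * product-pred rs) ≡⟨ cong (multiple *_) (pred-split ls rs perm) ⟩
        multiple * product-pred primes               ≤⟨ n≤1+n _ ⟩
        1 + multiple * product-pred primes           ≡⟨ N≡ ⟨
        N                                            ≡⟨ product-split ls rs perm ⟨
        product ls * product rs                      ∎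
    }
    where
    open ≤-Reasoning
    product-split : ∀ us vs → us ++ vs ↭ primes → product us * product vs ≡ N
    product-split us vs perm = trans (sym (product-++ us vs)) (trans (product-↭ perm) product≡)
    pred-split : ∀ us vs → us ++ vs ↭ primes → product-pred us * product-pred vs ≡ product-pred primes
    pred-split us vs perm = trans (sym (product-pred-++ us vs)) (product-↭ (↭-map⁺ pred perm))
    below′ : ∀ ys z zs → (ls ++ ys) ++ z ∷ zs ↭ primes → product (ls ++ ys) < multiple * product-pred (ls ++ ys)
    below′ ys z zs perm = lehmer-below (ls ++ ys) z zs 2≤multiple
      (All-++⁻ˡ (ls ++ ys) (All-resp-↭ (↭-sym perm) allEven))
      (λ 2∣ → odd (subst (2 ∣_) (product-split (ls ++ ys) (z ∷ zs) perm) (∣m⇒∣m*n _ 2∣)))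
      (All-++⁻ʳ (ls ++ ys) (All-resp-↭ (↭-sym perm) (All.map prime⇒2≤ allPrime)))
      (trans (product-split (ls ++ ys) (z ∷ zs) perm) (trans N≡ (cong (λ x → 1 + multiple * x) (sym (pred-split (ls ++ ys) (z ∷ zs) perm)))))

  2^length∣pred : 2 ^ length primes ∣ N ∸ 1
  2^length∣pred = subst (2 ^ length primes ∣_) (sym (cong (_∸ 1) N≡)) (∣n⇒∣m*n multiple (go allEven))
    where
    go : ∀ {xs} → All (λ p → 2 ∣ pred p) xs → 2 ^ length xs ∣ product-pred xs
    go []         = ∣-refl
    go (2∣ ∷ all) = *-pres-∣ 2∣ (go all)

-- 2-adic valuations

coprime-2^ : ∀ {o} k → 2 ∤ o → Coprime (2 ^ k) o
coprime-2^ k 2∤o = coprime-^ˡ k (prime∧∤⇒coprime prime[2] 2∤o)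

-- Stated for a variable decision procedure so that matching on `2≟ p` also reduces the filter.
product-2-split : (2≟ : ∀ p → Dec (2 ≡ p)) → ∀ {ps} → All Prime ps →
                  ∃[ o ] product ps ≡ 2 ^ length (filter 2≟ ps) * o × 2 ∤ o
product-2-split 2≟ []                  = 1 , refl , λ 2∣1 → contradiction (∣1⇒≡1 2∣1) λ ()
product-2-split 2≟ {p ∷ ps} (pp ∷ pps) with 2≟ p | product-2-split 2≟ pps
... | yes refl | o , eq , 2∤o = o , trans (cong (2 *_) eq) (sym (*-assoc 2 (2 ^ length (filter 2≟ ps)) o)) , 2∤o
... | no 2≢p   | o , eq , 2∤o = p * o , trans (cong (p *_) eq) (lemma p (2 ^ length (filter 2≟ ps)) o) ,
  λ 2∣po → [ 2≢p ∘ prime-∣-prime prime[2] pp , 2∤o ]′ (euclidsLemma p o prime[2] 2∣po)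
  where
  lemma : ∀ p x o → p * (x * o) ≡ x * (p * o)
  lemma = solve-∀

ν₂-split : ∀ m .{{_ : NonZero m}} → ∃[ o ] m ≡ 2 ^ ν₂ m * o × 2 ∤ o
ν₂-split m with product-2-split (2 ≟_) (PrimeFactorisation.factorsPrime (factorise m))
... | o , eq , 2∤o = o , trans (PrimeFactorisation.isFactorisation (factorise m)) eq , 2∤o

2^∣⇒≤ν₂ : ∀ k m .{{_ : NonZero m}} → 2 ^ k ∣ m → k ≤ ν₂ m
2^∣⇒≤ν₂ k m 2ᵏ∣m with ν₂-split m
... | o , eq , 2∤o = ≮⇒≥ λ ν<k → <⇒≱ (^-monoʳ-< 2 (s≤s (s≤s z≤n)) ν<k)
  (∣⇒≤ {{m^n≢0 2 (ν₂ m)}} (coprime-divisor (coprime-2^ k 2∤o) (subst (2 ^ k ∣_) (trans eq (*-comm _ o)) 2ᵏ∣m)))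

∣exponent⇒∣geom : ∀ {p x} n → x ≡1[ p ] → p ∣ n → p ∣ geom x n
∣exponent⇒∣geom n (t , refl) p∣n with geom-mod (t * _) n
... | u , eq = subst (_ ∣_) (sym eq) (∣m∣n⇒∣m+n p∣n (∣n⇒∣m*n u (n∣m*n t)))

-- For odd h the sum is odd. For h = 2 h′ it equals (1 + x) · geom (x²) h′ with 1 + x ≡ 2 modulo 4,
-- so halving h removes exactly one factor 2 from the sum.
2^∣geom⇒∣exponent : ∀ j {x} h → 1 ≤ h → x ≡1[ 4 ] → 2 ^ j ∣ geom x h → 2 ^ j ∣ h
2^∣geom⇒∣exponent j {x} h = go h j h ≤-refl
  where
  go : ∀ fuel j {x} h → h ≤ fuel → 1 ≤ h → x ≡1[ 4 ] → 2 ^ j ∣ geom x h → 2 ^ j ∣ h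
  go zero       _       h h≤0 1≤h _ _ = contradiction (≤-trans 1≤h h≤0) λ ()
  go (suc fuel) zero    h _ _ _ _ = 1∣ h
  go (suc fuel) (suc j) {x} h h≤ 1≤h x≡1@(t , refl) 2ʲ∣ with 2 ∣? h
  ... | no 2∤h = contradiction (∣geom∧≡1⇒∣exponent h (∣-trans (m∣m*n (2 ^ j)) 2ʲ∣) (t * 2 , cong suc (lemma t))) 2∤h
    where
    lemma : ∀ t → t * 4 ≡ t * 2 * 2
    lemma = solve-∀
  ... | yes (divides h′ refl) = subst (2 ^ suc j ∣_) (*-comm 2 h′) (*-monoʳ-∣ 2
    (go fuel j h′ (s≤s⁻¹ (≤-trans h′<h h≤)) 1≤h′ (≡1-^ 2 x≡1)
      (coprime-divisor (coprime-2^ j odd) (*-cancelˡ-∣ 2 (subst (2 ^ suc j ∣_) geom≡ 2ʲ∣)))))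
    where
    1≤h′ : 1 ≤ h′
    1≤h′ = n≢0⇒n>0 λ { refl → contradiction 1≤h λ () }
    h′<h : h′ < h′ * 2
    h′<h = subst (_< h′ * 2) (*-identityʳ h′) (*-monoʳ-< h′ {{>-nonZero 1≤h′}} {1} {2} (s≤s (s≤s z≤n)))
    odd : 2 ∤ 1 + t * 2
    odd 2∣ = prime≢1 prime[2] (∣1⇒≡1 (∣m+n∣m⇒∣n (subst (2 ∣_) (+-comm 1 (t * 2)) 2∣) (n∣m*n t)))
    lemma : ∀ t y → (1 + (1 + t * 4) * (1 + (1 + t * 4) * 0)) * y ≡ 2 * ((1 + t * 2) * y)
    lemma = solve-∀
    geom≡ : geom (1 + t * 4) (h′ * 2) ≡ 2 * ((1 + t * 2) * geom ((1 + t * 4) ^ 2) h′)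
    geom≡ = trans (cong (geom (1 + t * 4)) (*-comm h′ 2)) (trans (geom-* (1 + t * 4) 2 h′) (lemma t (geom ((1 + t * 4) ^ 2) h′)))

-- For even g the sum geom g m is odd, so 2^k ∣ g. For odd g, the oddness of geom g (m + 1) makes m
-- = 2 h even, and geom g m = (1 + g) · geom (g²) h with g² ≡ 1 modulo 4: beyond the ν₂(g + 1) twos
-- of the first factor, all others divide h.
2^∣pred-geom⇒≤ : ∀ {g} m k ν → 1 ≤ m → (2g : 2 ≤ g) → ν₂[g]+ν₂[g+1] g 2g ≤ ν → 2 ∤ geom g (suc m) →
                 2 ^ k ∣ g * geom g m → 2 ^ k ≤ 2 ^ ν * m
2^∣pred-geom⇒≤ {g@(suc y)} m k ν 1≤m 2≤g sum≤ν odd 2ᵏ∣ with 2 ∣? g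
... | yes 2∣g = ≤-trans (^-monoʳ-≤ 2 (≤-trans (2^∣⇒≤ν₂ k g 2ᵏ∣g) (≤-trans (m≤m+n (ν₂ g) (ν₂ (suc g))) sum≤ν)))
  (m≤m*n (2 ^ ν) m {{>-nonZero 1≤m}})
  where
  2ᵏ∣g : 2 ^ k ∣ g
  2ᵏ∣g = coprime-divisor (coprime-2^ k (λ 2∣geom → ∣geom⇒∤base m (prime≢1 prime[2]) 2∣geom 1≤m 2∣g))
    (subst (2 ^ k ∣_) (*-comm g (geom g m)) 2ᵏ∣)
... | no 2∤g with 2∤⇒2∣pred 2∤g
...   | divides u refl with 2∤⇒2∣pred {suc m} (odd ∘ ∣exponent⇒∣geom (suc m) (u , refl))
...     | divides h refl with ν₂-split (suc g)
...       | o , eq , 2∤o = ≤-trans 2ᵏ≤ (*-mono-≤ (^-monoʳ-≤ 2 (≤-trans (m≤n+m (ν₂ (suc g)) (ν₂ g)) sum≤ν)) (m≤m*n h 2))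
  where
  1≤h : 1 ≤ h
  1≤h = n≢0⇒n>0 λ { refl → contradiction 1≤m λ () }
  G = geom (g ^ 2) h
  lemma₁ : ∀ g y → (1 + g * (1 + g * 0)) * y ≡ suc g * y
  lemma₁ = solve-∀
  lemma₂ : ∀ u → (1 + u * 2) * ((1 + u * 2) * 1) ≡ 1 + (u + u * u) * 4
  lemma₂ = solve-∀
  2ᵏ∣νoG : 2 ^ k ∣ 2 ^ ν₂ (suc g) * (o * G)
  2ᵏ∣νoG = subst (2 ^ k ∣_)
    (trans (cong (geom g) (*-comm h 2)) (trans (geom-* g 2 h) (trans (lemma₁ g G) (trans (cong (_* G) eq) (*-assoc (2 ^ ν₂ (suc g)) o G)))))
    (coprime-divisor (coprime-2^ k 2∤g) 2ᵏ∣)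
  2ᵏ≤ : 2 ^ k ≤ 2 ^ ν₂ (suc g) * h
  2ᵏ≤ with ≤-total k (ν₂ (suc g))
  ... | inj₁ k≤ν = ≤-trans (^-monoʳ-≤ 2 k≤ν) (m≤m*n (2 ^ ν₂ (suc g)) h {{>-nonZero 1≤h}})
  ... | inj₂ ν≤k = subst (_≤ 2 ^ ν₂ (suc g) * h) (sym 2ᵏ≡)
    (*-monoʳ-≤ (2 ^ ν₂ (suc g)) (∣⇒≤ {{>-nonZero 1≤h}} (2^∣geom⇒∣exponent i h 1≤h (u + u * u , lemma₂ u)
      (coprime-divisor (coprime-2^ i 2∤o) (*-cancelˡ-∣ (2 ^ ν₂ (suc g)) {{m^n≢0 2 (ν₂ (suc g))}} (subst (_∣ 2 ^ ν₂ (suc g) * (o * G)) 2ᵏ≡ 2ᵏ∣νoG))))))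
    where
    i = k ∸ ν₂ (suc g)
    2ᵏ≡ : 2 ^ k ≡ 2 ^ ν₂ (suc g) * 2 ^ i
    2ᵏ≡ = trans (cong (2 ^_) (sym (m+[n∸m]≡n ν≤k))) (^-distribˡ-+-* 2 (ν₂ (suc g)) i)

-- The chain of divisors of the exponent

-- The constant 8 is forced by j = 3, where equality holds.
cube≤8*2^ : ∀ j → suc j * suc j * suc j ≤ 8 * 2 ^ j
cube≤8*2^ 0 = s≤s z≤n
cube≤8*2^ 1 = m≤m+n 8 8
cube≤8*2^ 2 = m≤m+n 27 5
cube≤8*2^ (suc (suc (suc d))) = from-4 d
  where
  open ≤-Reasoning
  lemma₁ : ∀ d → 2 * ((4 + d) * (4 + d) * (4 + d)) ≡ (5 + d) * (5 + d) * (5 + d) + (3 + d * (21 + d * (9 + d)))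
  lemma₁ = solve-∀
  lemma₂ : ∀ x → 2 * (8 * x) ≡ 8 * (2 * x)
  lemma₂ = solve-∀
  from-4 : ∀ d → (4 + d) * (4 + d) * (4 + d) ≤ 8 * 2 ^ (3 + d)
  from-4 zero    = ≤-refl
  from-4 (suc d) = begin
    (5 + d) * (5 + d) * (5 + d)                                     ≤⟨ m≤m+n _ _ ⟩
    (5 + d) * (5 + d) * (5 + d) + (3 + d * (21 + d * (9 + d)))      ≡⟨ lemma₁ d ⟨
    2 * ((4 + d) * (4 + d) * (4 + d))                               ≤⟨ *-monoʳ-≤ 2 (from-4 d) ⟩
    2 * (8 * 2 ^ (3 + d))                                           ≡⟨ lemma₂ (2 ^ (3 + d)) ⟩
    8 * 2 ^ (4 + d)                                                 ∎

^-cancelʳ-≤ : ∀ {x y} n .{{_ : NonZero n}} → x ^ n ≤ y ^ n → x ≤ y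
^-cancelʳ-≤ n le = ≮⇒≥ λ y<x → <⇒≱ (^-monoˡ-< n y<x) le

^-cancelˡ-≤ : ∀ {m n} → 2 ^ m ≤ 2 ^ n → m ≤ n
^-cancelˡ-≤ le = ≮⇒≥ λ n<m → <⇒≱ (^-monoʳ-< 2 (s≤s (s≤s z≤n)) n<m) le

^-comm : ∀ x m n → (x ^ m) ^ n ≡ (x ^ n) ^ m
^-comm x m n = trans (^-*-assoc x m n) (trans (cong (x ^_) (*-comm m n)) (sym (^-*-assoc x n m)))

^-≤-double : ∀ x {m n} .{{_ : NonZero x}} ℓ k → m ≤ x ^ (2 ^ k) → 2 ^ k ≤ 2 ^ ℓ * n → m ≤ (x ^ (2 ^ ℓ)) ^ n
^-≤-double x {m} {n} ℓ k m≤ 2ᵏ≤ = ≤-trans m≤ (≤-trans (^-monoʳ-≤ x 2ᵏ≤) (≤-reflexive (sym (^-*-assoc x (2 ^ ℓ) n))))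

-- logBase ℓ e bounds the binary logarithm of g ^ e, and step ℓ e the cofactor by which
-- the divisor e of the exponent can be enlarged.
logBase blockLog step : ℕ → ℕ → ℕ
logBase ℓ e = 2 ^ suc ℓ * e
blockLog ℓ e = 8 * (suc (logBase ℓ e) * 2 ^ ℓ)
step ℓ e = 2 ^ (blockLog ℓ e + logBase ℓ e)

step≢0 : ∀ ℓ e → NonZero (step ℓ e)
step≢0 ℓ e = m^n≢0 2 (blockLog ℓ e + logBase ℓ e)

step-mono : ∀ ℓ {e e′} → e ≤ e′ → step ℓ e ≤ step ℓ e′
step-mono ℓ e≤e′ = ^-monoʳ-≤ 2 (+-mono-≤ (*-monoʳ-≤ 8 (*-monoˡ-≤ (2 ^ ℓ) (s≤s log≤))) log≤)
  where log≤ = *-monoʳ-≤ (2 ^ suc ℓ) e≤e′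

-- Bounds the divisor of n reached after i enlargements. The initial prime q divides the cofactor
-- found for e = 1, whence the value `step ℓ 1`.
chainBound : ℕ → ℕ → ℕ
chainBound ℓ zero    = step ℓ 1
chainBound ℓ (suc i) = step ℓ (chainBound ℓ i) * chainBound ℓ i

-- The factor in front of 2^ℓ is at most (j + 1)² (1 + A), while 8 · 2^j ≥ (j + 1)³; cancel (j +
-- 1)².
block-length-bound : ∀ j A ℓ → 2 ^ j ≤ (suc (j * j) + A * suc j) * 2 ^ ℓ → suc j ≤ 8 * (suc A * 2 ^ ℓ)
block-length-bound j A ℓ le = *-cancelˡ-≤ (suc j * suc j) (begin
  suc j * suc j * suc j                        ≤⟨ cube≤8*2^ j ⟩
  8 * 2 ^ j                                    ≤⟨ *-monoʳ-≤ 8 (≤-trans le (*-monoˡ-≤ (2 ^ ℓ) (≤-trans (m≤m+n (suc (j * j) + A * suc j) (j + j + A * j * suc j)) (≤-reflexive (lemma₁ j A))))) ⟩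
  8 * (suc j * suc j * suc A * 2 ^ ℓ)          ≡⟨ lemma₂ (suc j * suc j) (suc A) (2 ^ ℓ) ⟩
  suc j * suc j * (8 * (suc A * 2 ^ ℓ))        ∎)
  where
  open ≤-Reasoning
  lemma₁ : ∀ j A → suc (j * j) + A * suc j + (j + j + A * j * suc j) ≡ suc j * suc j * suc A
  lemma₁ = solve-∀
  lemma₂ : ∀ x y z → 8 * (x * y * z) ≡ x * (8 * (y * z))
  lemma₂ = solve-∀

module BoundedRepunit {g m ℓ : ℕ} (2≤g : 2 ≤ g) (1≤m : 1 ≤ m) (φ∣ : φ (geom g (suc m)) ∣ geom g (suc m) ∸ 1)
                      (fac : LehmerFactorisation (geom g (suc m)))
                      (2^k≤ : 2 ^ length (LehmerFactorisation.primes fac) ≤ 2 ^ ℓ * m) where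
  open LehmerFactorisation fac
  open LehmerRepunit {g} {suc m} 2≤g (s≤s 1≤m) φ∣

  private
    n = suc m
    N = geom g n
    k = length primes
    instance
      g≢0 : NonZero g
      g≢0 = >-nonZero (<-trans z<s 2≤g)
      m≢0 : NonZero m
      m≢0 = >-nonZero 1≤m

  1≤primes : ∀ {xs} → All Prime xs → All (1 ≤_) xs
  1≤primes = All.map (≤-trans (s≤s z≤n) ∘ prime⇒2≤)

  -- Nielsen's inequality for all primes of N starts from a = 1, so 2 (1 + a) = 4.
  base-bound : g ≤ 2 ^ (2 ^ suc ℓ)
  base-bound = ^-cancelʳ-≤ m (begin
    g ^ m                     ≤⟨ ^-≤-double 4 ℓ k N≤ 2^k≤ ⟩
    (4 ^ (2 ^ ℓ)) ^ m         ≡⟨ cong (_^ m) (^-*-assoc 2 2 (2 ^ ℓ)) ⟩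
    (2 ^ (2 ^ suc ℓ)) ^ m     ∎)
    where
    open ≤-Reasoning
    N≤ : g ^ m ≤ 4 ^ (2 ^ k)
    N≤ = begin
      g ^ m                          ≤⟨ geom-lower g m ⟩
      N                              ≡⟨ product≡ ⟨
      product primes                 ≡⟨ *-identityˡ (product primes) ⟨
      1 * product primes             ≤⟨ n≤1+n _ ⟩
      suc (1 * product primes)       ≤⟨ m≤m+n _ _ ⟩
      2 * suc (1 * product primes)   ≤⟨ growth (s≤s z≤n) sorted (1≤primes allPrime) (lehmer-admissible fac [] primes ↭-refl) ⟩
      4 ^ (2 ^ k)                    ∎

  g^≤2^ : ∀ e → g ^ e ≤ 2 ^ logBase ℓ e
  g^≤2^ e = ≤-trans (^-monoˡ-≤ e base-bound) (≤-reflexive (^-*-assoc 2 (2 ^ suc ℓ) e))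

  -- Let a be the product of the primes of N that divide geom g e. It divides geom g e, so 1 + a ≤
  -- g^e, and the other primes are admissible with starting value a. Their first entry is at most
  -- 2^j (1 + a) for a small prefix of length j, so only j has to be bounded.
  smallest-new-prime : ∀ e → 1 ≤ e → e < n → ∃[ p ] Prime p × p ∣ N × p ∤ geom g e × p ≤ step ℓ e
  smallest-new-prime e 1≤e e<n = find (separate (_∣? geom g e) primes sorted)
    where
    find : Separation (_∣ geom g e) primes → ∃[ p ] Prime p × p ∣ N × p ∤ geom g e × p ≤ step ℓ e
    find record { left = ls ; right = rs ; permutation = perm ; left-holds = ls∣ ; right-fails = rs∤ ; right-sorted = rs-sorted } =
      from-right rs refl
      where
      a = product ls
      all↭ : ∀ {P : ℕ → Set} → All P primes → All P (ls ++ rs)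
      all↭ = All-resp-↭ (↭-sym perm)
      a*rs≡N : a * product rs ≡ N
      a*rs≡N = trans (sym (product-++ ls rs)) (trans (product-↭ perm) product≡)
      ls-prime : All Prime ls
      ls-prime = All-++⁻ˡ ls (all↭ allPrime)
      a∣geom : a ∣ geom g e
      a∣geom = primes-∣⇒product-∣ ls-prime (squarefree-∣ (subst (a ∣_) a*rs≡N (m∣m*n (product rs))) squarefree) ls∣
      1≤a : 1 ≤ a
      1≤a = product-≥1 (1≤primes ls-prime)
      1+a≤ : suc a ≤ g ^ e
      1+a≤ = ≤-trans (s≤s (∣⇒≤ {{>-nonZero (geom≥1 g 1≤e)}} a∣geom)) (geom-upper g e 2≤g)
      from-right : ∀ xs → xs ≡ rs → ∃[ p ] Prime p × p ∣ N × p ∤ geom g e × p ≤ step ℓ e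
      -- With no prime left, N = a, against 1 + a ≤ g^e ≤ g^m ≤ N.
      from-right [] refl = contradiction (≤-trans 1+a≤ (≤-trans (^-monoʳ-≤ g (s≤s⁻¹ e<n)) (geom-lower g m)))
        (<⇒≱ (≤-reflexive (cong suc (trans (sym a*rs≡N) (*-identityʳ a)))))
      from-right (x ∷ xs) refl = from-prefix (admissible⇒smallPrefix rs-sorted adm)
        where
        adm : Admissible a (multiple * product-pred ls) (x ∷ xs)
        adm = lehmer-admissible fac ls (x ∷ xs) perm
        from-prefix : SmallPrefix (suc a) (x ∷ xs) → ∃[ p ] Prime p × p ∣ N × p ∤ geom g e × p ≤ step ℓ e
        from-prefix record { head = p ; tail = t ; rest = r ; split = refl ; small = small } =
          p , All.head right-prime , subst (p ∣_) a*rs≡N (∣n⇒∣m*n a (m∣m*n _)) , All.head rs∤ ,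
          (begin
            p                                   ≤⟨ All.head small ⟩
            2 ^ j * suc a                       ≤⟨ *-mono-≤ (^-monoʳ-≤ 2 (≤-trans (n≤1+n j) (block-length-bound j (logBase ℓ e) ℓ 2ʲ≤))) (≤-trans 1+a≤ (g^≤2^ e)) ⟩
            2 ^ blockLog ℓ e * 2 ^ logBase ℓ e  ≡⟨ ^-distribˡ-+-* 2 (blockLog ℓ e) (logBase ℓ e) ⟨
            step ℓ e                            ∎)
          where
          open ≤-Reasoning
          block = p ∷ t
          j = length block
          right-prime : All Prime (block ++ r)
          right-prime = All-++⁻ʳ ls (all↭ allPrime)
          right≥1 : All (1 ≤_) (block ++ r)
          right≥1 = 1≤primes right-prime
          -- The bound for the first block before `block-bound` coarsens it; the coarse form (2 (1 +
          -- a))^(2^j) would make the comparison below independent of j.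
          Q = 2 ^ suc (j * j) * suc a ^ suc j
          instance
            Q≢0 : NonZero Q
            Q≢0 = m*n≢0 (2 ^ suc (j * j)) (suc a ^ suc j) {{m^n≢0 2 (suc (j * j))}} {{m^n≢0 (suc a) (suc j)}}
          k≥ : length r + j ≤ k
          k≥ = begin
            length r + j                ≡⟨ +-comm (length r) j ⟩
            j + length r                ≡⟨ length-++ block ⟨
            length (block ++ r)         ≤⟨ m≤n+m _ (length ls) ⟩
            length ls + length (block ++ r) ≡⟨ length-++ ls ⟨
            length (ls ++ block ++ r)   ≡⟨ ↭-length perm ⟩
            k                           ∎
          a-block-rest : a * product block * product r ≡ N
          a-block-rest = trans (*-assoc a (product block) (product r)) (trans (cong (a *_) (sym (product-++ block r))) a*rs≡N)
          g^m≤ : g ^ m ≤ Q ^ (2 ^ length r)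
          g^m≤ = begin
            g ^ m                                            ≤⟨ geom-lower g m ⟩
            N                                                ≡⟨ a-block-rest ⟨
            a * product block * product r                    ≤⟨ n≤1+n _ ⟩
            suc (a * product block * product r)              ≤⟨ m≤m+n _ _ ⟩
            2 * suc (a * product block * product r)          ≤⟨ growth (*-mono-≤ 1≤a (product-≥1 (All-++⁻ˡ block right≥1)))
                                                                  (AllPairs-++⁻ʳ block rs-sorted) (All-++⁻ʳ block right≥1) (admissible-drop block adm) ⟩
            (2 * suc (a * product block)) ^ (2 ^ length r)   ≤⟨ ^-monoˡ-≤ (2 ^ length r) (prefix-product-bound a (All-++⁻ˡ block right≥1) small) ⟩
            Q ^ (2 ^ length r)                               ∎
          g^2ʲ≤ : g ^ (2 ^ j) ≤ Q ^ (2 ^ ℓ)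
          g^2ʲ≤ = ^-cancelʳ-≤ m (begin
            (g ^ (2 ^ j)) ^ m                 ≡⟨ ^-comm g (2 ^ j) m ⟩
            (g ^ m) ^ (2 ^ j)                 ≤⟨ ^-monoˡ-≤ (2 ^ j) g^m≤ ⟩
            (Q ^ (2 ^ length r)) ^ (2 ^ j)    ≡⟨ ^-*-assoc Q (2 ^ length r) (2 ^ j) ⟩
            Q ^ (2 ^ length r * 2 ^ j)        ≡⟨ cong (Q ^_) (^-distribˡ-+-* 2 (length r) j) ⟨
            Q ^ (2 ^ (length r + j))          ≤⟨ ^-monoʳ-≤ Q (^-monoʳ-≤ 2 k≥) ⟩
            Q ^ (2 ^ k)                       ≤⟨ ^-≤-double Q ℓ k ≤-refl 2^k≤ ⟩
            (Q ^ (2 ^ ℓ)) ^ m                 ∎)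
          A = logBase ℓ e
          Q≤ : Q ≤ 2 ^ (suc (j * j) + A * suc j)
          Q≤ = begin
            2 ^ suc (j * j) * suc a ^ suc j       ≤⟨ *-monoʳ-≤ (2 ^ suc (j * j)) (^-monoˡ-≤ (suc j) (≤-trans 1+a≤ (g^≤2^ e))) ⟩
            2 ^ suc (j * j) * (2 ^ A) ^ suc j     ≡⟨ cong (2 ^ suc (j * j) *_) (^-*-assoc 2 A (suc j)) ⟩
            2 ^ suc (j * j) * 2 ^ (A * suc j)     ≡⟨ ^-distribˡ-+-* 2 (suc (j * j)) (A * suc j) ⟨
            2 ^ (suc (j * j) + A * suc j)         ∎
          2ʲ≤ : 2 ^ j ≤ (suc (j * j) + A * suc j) * 2 ^ ℓ
          2ʲ≤ = ^-cancelˡ-≤ (begin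
            2 ^ (2 ^ j)                                   ≤⟨ ^-monoˡ-≤ (2 ^ j) 2≤g ⟩
            g ^ (2 ^ j)                                   ≤⟨ g^2ʲ≤ ⟩
            Q ^ (2 ^ ℓ)                                   ≤⟨ ^-monoˡ-≤ (2 ^ ℓ) Q≤ ⟩
            (2 ^ (suc (j * j) + A * suc j)) ^ (2 ^ ℓ)     ≡⟨ ^-*-assoc 2 (suc (j * j) + A * suc j) (2 ^ ℓ) ⟩
            2 ^ ((suc (j * j) + A * suc j) * 2 ^ ℓ)       ∎)

  -- If r were 1, the cofactor f would be prime to p - 1, so g^(e f) ≡ 1 would give g^e ≡ 1 modulo
  -- p, and then p ∣ geom g e.
  next-divisor : ∀ e → e ∣ n → e < n → ∃[ r ] 2 ≤ r × r * e ∣ n × r ≤ step ℓ e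
  next-divisor e (divides f n≡fe) e<n with smallest-new-prime e (exponent-factor≥1 (divides f n≡fe)) e<n
  ... | p , pp , p∣N , p∤geom , p≤ = r , 2≤r , subst (r * e ∣_) (sym n≡fe) (*-monoˡ-∣ e (gcd[m,n]∣m f (p ∸ 1))) ,
    ≤-trans (∣⇒≤ {{>-nonZero p-1≥1}} (gcd[m,n]∣n f (p ∸ 1))) (≤-trans (m∸n≤m p 1) p≤)
    where
    r = gcd f (p ∸ 1)
    p-1≥1 : 1 ≤ p ∸ 1
    p-1≥1 = m<n⇒0<n∸m (prime⇒2≤ pp)
    -- g ≡ 1 modulo p would give N ≡ n, hence p ∣ n.
    p∤g-1 : p ∤ g ∸ 1
    p∤g-1 (divides t g-1≡) = prime∣⇒∤exponent pp p∣N (∣geom∧≡1⇒∣exponent n p∣N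
      (t , trans (sym (m+[n∸m]≡n (<⇒≤ 2≤g))) (cong suc g-1≡)))
    r≢1 : r ≢ 1
    r≢1 r≡1 = p∤geom (≡1⇒∣geom e pp p∤g-1 (coprime-exponent e f pp (∣geom⇒∤base n (prime≢1 pp) p∣N (s≤s z≤n))
      (subst (λ i → g ^ i ≡1[ p ]) (trans n≡fe (*-comm f e)) (∣geom⇒≡1 g n p∣N))
      (Coprimality.gcd≡1⇒coprime r≡1)))
    2≤r : 2 ≤ r
    2≤r with r in eq
    ... | zero        = contradiction (0∣⇒≡0 (subst (_∣ p ∸ 1) eq (gcd[m,n]∣n f (p ∸ 1)))) (>⇒≢ p-1≥1)
    ... | 1           = contradiction eq r≢1
    ... | suc (suc _) = s≤s (s≤s z≤n)

  Chain : ℕ → ℕ → Set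
  Chain q i = ∃[ rs ] length rs ≡ i × All (2 ≤_) rs × q * product rs ∣ n × q * product rs ≤ chainBound ℓ i

  small-prime-divisor : ∃[ q ] Prime q × q ∣ n × q ≤ step ℓ 1
  small-prime-divisor with next-divisor 1 (1∣ n) (s≤s 1≤m)
  ... | r , 2≤r , r1∣n , r≤ with ∃prime∣ 2≤r
  ...   | q , pq , q∣r = q , pq , ∣-trans q∣r (∣-trans (m∣m*n 1) r1∣n) ,
    ≤-trans (∣⇒≤ {{>-nonZero (<-trans z<s 2≤r)}} q∣r) r≤

  -- The first alternative records that the chain has already reached n; it persists because
  -- `chainBound` does not decrease.
  chain : ∀ {q} → q ∣ n → q ≤ step ℓ 1 → ∀ i → n ≤ chainBound ℓ i ⊎ Chain q i
  chain {q} q∣n q≤ zero    = inj₂ ([] , refl , [] , subst (_∣ n) (sym (*-identityʳ q)) q∣n , subst (_≤ step ℓ 1) (sym (*-identityʳ q)) q≤)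
  chain {q} q∣n q≤ (suc i) with chain q∣n q≤ i
  ... | inj₁ n≤ = inj₁ (≤-trans n≤ (m≤n*m (chainBound ℓ i) (step ℓ (chainBound ℓ i)) {{step≢0 ℓ (chainBound ℓ i)}}))
  ... | inj₂ (rs , len , 2≤rs , e∣n , e≤) with q * product rs <? n
  ...   | no e≮n = inj₁ (≤-trans (≮⇒≥ e≮n) (≤-trans e≤ (m≤n*m (chainBound ℓ i) (step ℓ (chainBound ℓ i)) {{step≢0 ℓ (chainBound ℓ i)}})))
  ...   | yes e<n with next-divisor (q * product rs) e∣n e<n
  ...     | r , 2≤r , re∣n , r≤ = inj₂ (r ∷ rs , cong suc len , 2≤r ∷ 2≤rs , subst (_∣ n) (lemma r q (product rs)) re∣n ,
    ≤-trans (≤-reflexive (sym (lemma r q (product rs)))) (*-mono-≤ (≤-trans r≤ (step-mono ℓ e≤)) e≤))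
    where
    lemma : ∀ r q x → r * (q * x) ≡ q * (r * x)
    lemma = solve-∀

  chain-length-bound : ∀ {q i} → Prime q → Chain q i → suc i ≤ logBase ℓ q
  chain-length-bound {q} pq (rs , refl , 2≤rs , e∣n , _) = ^-cancelˡ-≤ (begin
    2 ^ suc (length rs)   ≤⟨ ^-monoˡ-≤ (suc (length rs)) (prime⇒2≤ pq) ⟩
    q ^ suc (length rs)   ≤⟨ prime-power-≤ (suc (length rs)) pq (∣-trans (m∣m*n (product rs)) e∣n)
                               (∣-trans (prime-power∣φ pq rs 2≤rs e∣n) (∣-trans (φ-mono-∣ {{N≢0}} (geom-∣ g e∣n)) φ∣)) ⟩
    g ^ q                 ≤⟨ g^≤2^ q ⟩
    2 ^ logBase ℓ q       ∎)
    where open ≤-Reasoning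

  -- A chain with `logBase ℓ (step ℓ 1)` enlargements would be one longer than `chain-length-bound`
  -- allows for q ≤ `step ℓ 1`, so n is reached by then.
  exponent-bound : n ≤ chainBound ℓ (logBase ℓ (step ℓ 1))
  exponent-bound with small-prime-divisor
  ... | q , pq , q∣n , q≤ with chain q∣n q≤ (logBase ℓ (step ℓ 1))
  ...   | inj₁ n≤ = n≤
  ...   | inj₂ ch = contradiction (≤-trans (chain-length-bound pq ch) (*-monoʳ-≤ (2 ^ suc ℓ) q≤)) (<⇒≱ ≤-refl)

-- The bound in terms of ℓ

lehmerBound : ℕ → ℕ
lehmerBound ℓ = (2 ^ (2 ^ suc ℓ)) ^ chainBound ℓ (logBase ℓ (step ℓ 1))

composite-geom⇒2≤ : ∀ g n → Composite (geom g n) → 2 ≤ n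
composite-geom⇒2≤ g 0 comp = contradiction (nonTrivial⇒n>1 0 {{composite⇒nonTrivial comp}}) λ ()
composite-geom⇒2≤ g 1 comp = contradiction
  (subst (1 <_) (geom-1 g) (nonTrivial⇒n>1 _ {{composite⇒nonTrivial comp}})) (<⇒≱ ≤-refl)
composite-geom⇒2≤ g (suc (suc n)) _ = s≤s (s≤s z≤n)

lehmer-geom-bound : ∀ {g n ℓ} (2≤g : 2 ≤ g) → ν₂[g]+ν₂[g+1] g 2≤g ≤ ℓ → Lehmer (geom g n) → geom g n ≤ lehmerBound ℓ
lehmer-geom-bound {g} {0} 2≤g _ _ = z≤n
lehmer-geom-bound {g} {1} 2≤g _ (comp , _) = contradiction (composite-geom⇒2≤ g 1 comp) (<⇒≱ ≤-refl)
lehmer-geom-bound {g} {suc m@(suc _)} {ℓ} 2≤g sum≤ leh = begin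
  geom g (suc m)                 ≤⟨ n≤1+n _ ⟩
  suc (geom g (suc m))           ≤⟨ geom-upper g (suc m) 2≤g ⟩
  g ^ suc m                      ≤⟨ ^-monoˡ-≤ (suc m) base-bound ⟩
  (2 ^ (2 ^ suc ℓ)) ^ suc m      ≤⟨ ^-monoʳ-≤ (2 ^ (2 ^ suc ℓ)) {{m^n≢0 2 (2 ^ suc ℓ)}} exponent-bound ⟩
  lehmerBound ℓ                  ∎
  where
  open ≤-Reasoning
  fac = lehmerFactorisation {geom g (suc m)} leh
  open BoundedRepunit {g} {m} {ℓ} 2≤g (s≤s z≤n) (proj₂ leh) fac
    (2^∣pred-geom⇒≤ m (length (LehmerFactorisation.primes fac)) ℓ (s≤s z≤n) 2≤g sum≤ (LehmerFactorisation.odd fac) (2^length∣pred fac))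

repunit≡geom : ∀ g n (2≤g : 2 ≤ g) → repunit g n 2≤g ≡ geom g n
repunit≡geom (suc y) n 2≤g@(s≤s 1≤y) =
  trans (cong (λ x → ((x ∸ 1) / y) {{>-nonZero (m<n⇒0<n∸m 2≤g)}}) (geom-^ y n))
        (m*n/n≡m (geom (suc y) n) y {{>-nonZero (m<n⇒0<n∸m 2≤g)}})

base≤geom : ∀ g n → 2 ≤ n → g ≤ geom g n
base≤geom g (suc (suc n)) _ = ≤-trans (m≤m*n g (geom g (suc n))) (n≤1+n _)
base≤geom g (suc zero) (s≤s ())

-- Dedekind reals

upper-mono : ∀ (x : ℝ) {p q} → p ℚ.≤ q → upper x p → upper x q
upper-mono x {p} {q} p≤q up with Equivalence.to (upper-rounded x p) up
... | r , r<p , ur = Equivalence.from (upper-rounded x q) (r , ℚ.<-≤-trans r<p p≤q , ur)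

fromℕ-mono : ∀ {m n} → m ≤ n → fromℕ m ℚ.≤ fromℕ n
fromℕ-mono m≤n = ℚ.*≤* (ℤ.*-monoʳ-≤-nonNeg (ℤ.+ 1) (ℤ.+≤+ m≤n))

≤fromℕ∣numerator∣ : ∀ q → q ℚ.≤ fromℕ (ℤ.∣ ℚ.↥ q ∣)
≤fromℕ∣numerator∣ (mkℚ (ℤ.+ n)     d c) = ℚ.*≤* (ℤ.*-monoˡ-≤-nonNeg (ℤ.+ n) (ℤ.+≤+ (s≤s z≤n)))
≤fromℕ∣numerator∣ (mkℚ ℤ.-[1+ n ] d c) = ℚ.*≤* ℤ.-≤+

≤ᴿ∧<ᴿ⇒< : ∀ x {m n} → m ≤ᴿ x → x <ᴿ n → m < n
≤ᴿ∧<ᴿ⇒< x m≤x x<n = ≰⇒> λ n≤m → m≤x (upper-mono x (fromℕ-mono n≤m) x<n)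

lehmer-repunit-bound : ∀ (L : ℝ) {ℓ N} → L <ᴿ suc ℓ → RepunitSet L N → Lehmer N → N ≤ lehmerBound ℓ
lehmer-repunit-bound L L<ℓ (g , n , 2≤g , _ , sum≤L , refl) leh = subst (_≤ _) (sym (repunit≡geom g n 2≤g))
  (lehmer-geom-bound {g} {n} 2≤g (s≤s⁻¹ (≤ᴿ∧<ᴿ⇒< L sum≤L L<ℓ)) (subst Lehmer (repunit≡geom g n 2≤g) leh))

-- Membership of repunit g n in RepunitSet L may be witnessed by another base and exponent,
-- so g and n are bounded through the value of the repunit.
corollary3p5 : Σ[ G ∈ (ℕ → ℕ) ] Σ[ M ∈ (ℕ → ℕ) ] ((L : ℝ) → 1 ≤ᴿ L →
    Finite (λ N → RepunitSet L N × Lehmer N)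
    × ((ℓ : ℕ) → IsFloor L ℓ →
    (g n : ℕ) (2≤g : 2 ≤ g) → 1 ≤ n →
    RepunitSet L (repunit g n 2≤g) → Lehmer (repunit g n 2≤g) →
    g ≤ G ℓ × n ≤ M ℓ))
corollary3p5 = lehmerBound , lehmerBound , λ L _ → finite L , effective L
  where
  finite : ∀ L → Finite (λ N → RepunitSet L N × Lehmer N)
  finite L with upper-inhabited L
  -- Finiteness has to be proved without computing a floor of L; the absolute value of the numerator
  -- of any rational above L takes the place of ℓ.
  ... | q , L<q = upTo (suc (lehmerBound b)) , λ N (rep , leh) → ∈-upTo⁺ (s≤s (lehmer-repunit-bound L L<b rep leh))
    where
    b = ℤ.∣ ℚ.↥ q ∣
    L<b : L <ᴿ suc b
    L<b = upper-mono L (ℚ.≤-trans (≤fromℕ∣numerator∣ q) (fromℕ-mono (n≤1+n b))) L<q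

  effective : ∀ L ℓ → IsFloor L ℓ → ∀ g n (2≤g : 2 ≤ g) → 1 ≤ n → RepunitSet L (repunit g n 2≤g) →
              Lehmer (repunit g n 2≤g) → g ≤ lehmerBound ℓ × n ≤ lehmerBound ℓ
  effective L ℓ (_ , L<ℓ) g n 2≤g _ rep leh =
    ≤-trans (base≤geom g n 2≤n) geom≤ , ≤-trans (<⇒≤ (geom-> n 2≤n 2≤g)) geom≤
    where
    eq = repunit≡geom g n 2≤g
    geom≤ : geom g n ≤ lehmerBound ℓ
    geom≤ = subst (_≤ lehmerBound ℓ) eq (lehmer-repunit-bound L L<ℓ rep leh)
    2≤n : 2 ≤ n
    2≤n = composite-geom⇒2≤ g n (subst Composite eq (proj₁ leh))
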